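{- The regret upper bound $\mathcal O\left(NM\hat p\left(\frac1\lambda\sqrt{UT\log T}+\varepsilon\sqrt T\right)\right)$ of the UCB-Add-On algorithm for the online add-on discount revenue management problem is tight up to the logarithmic term. More specifically, the regret is lower-bounded by $$\Omega\left(NM\hat p\sqrt{UT}\right):$$ there is a problem instance on which this part of the regret is inevitable for any learning algorithm. Such an instance is obtained by taking the add-on space limit $S=0$, primary demand $\alpha_{N+m}(p)=0$ and add-on purchase probability $\beta_{N+m}(p)=1$ for all supportive products $m=1,\dots,M$ and all $p\in\Omega_s$, with (for simplicity) $\hat p$ the only price available for the supportive products.
   Context: **Problem.** There are $N$ core products and $M$ supportive products, finite sets $\Omega_c,\Omega_s,\Omega_a$ of nonnegative prices (for core products, supportive products and add-on discounts), an integer space limit $S\ge 0$, and demand functions $\alpha_n:\Omega_c\to[0,1]$ ($n=1,\dots,N$), $\alpha_{N+m}:\Omega_s\to[0,1]$, $\beta_{N+m}:\Omega_s\to[0,1]$, $\beta'_{N+m}:\Omega_a\to[0,1]$ ($m=1,\dots,M$). A feasible policy $\Pi$ specifies $p_n\in\Omega_c$ for $n=1,\dots,N$ and $p_{N+m}\in\Omega_s$, $p'_{N+m}\in\Omega_a$, $I_{N+m}\in\{0,1\}$ for $m=1,\dots,M$, with $\sum_{m=1}^M I_{N+m}\le S$ and $p'_{N+m}<p_{N+m}$ for all $m=1,\dots,M$. Its one-period expected revenue is $$\mathcal R(\Pi)=\sum_{n=1}^N\alpha_n(p_n)p_n+\sum_{m=1}^M\alpha_{N+m}(p_{N+m})p_{N+m}+\Big[\sum_{n=1}^N\alpha_n(p_n)\Big]\sum_{m=1}^M\Big[I_{N+m}\beta'_{N+m}(p'_{N+m})p'_{N+m}+(1-I_{N+m})\beta_{N+m}(p_{N+m})p_{N+m}\Big].$$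 $\mathcal R^*$ is the maximum of $\mathcal R(\Pi)$ over feasible policies; $\hat p:=\max_{p\in\Omega_c\cup\Omega_s}p$; $U:=\max\{|\Omega_c|,|\Omega_s|,|\Omega_a|\}$. **Demand.** In each period $t=1,\dots,T$ under policy $\Pi$, the primary demand for core product $n$ is Bernoulli with mean $\alpha_n(p_n)$ and the primary demand for supportive product $m$ is Bernoulli with mean $\alpha_{N+m}(p_{N+m})$. A customer who has purchased one core product continues to purchase supportive product $m$ (add-on purchase) with probability $\beta'_{N+m}(p'_{N+m})$ if $I_{N+m}=1$ and $\beta_{N+m}(p_{N+m})$ if $I_{N+m}=0$. Demand is independent across products. Purchases are observed; the demand functions are unknown. $\lambda$ is the lowest possible probability that the total primary demand is non-zero. **Learning algorithm and regret.** A learning algorithm chooses the policy $\Pi_t$ in each period from past observations, without knowledge of the demand functions. $\mathrm{Regret}(T)=\mathbf E\big[\sum_{t=1}^T(\mathcal R^*-\mathcal R(\Pi_t))\big]$. **Discretized DP Algorithm** (input: the price sets, all values of the demand functions, and a positive integer $K$). Part 1. For each $m$ and each $\gamma\in\{0,\frac1K,\dots,\frac{NK}{K}\}$, compute $r_{N+m}(\gamma)=\max_{p\in\Omega_s}\{\alpha_{N+m}(p)p+\gamma\beta_{N+m}(p)p\}$ and $r'_{N+m}(\gamma)=\max_{p\in\Omega_s,\,p'\in\Omega_a,\,p'<p}\{\alpha_{N+m}(p)p+\gamma\beta'_{N+m}(p')p'\}$. For each $\gamma$, sort $r'_{N+m}(\gamma)-r_{N+m}(\gamma)$ in descending order; set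 $I_{N+m}(\gamma)=1$ if this difference is positive and among the first $S$ entries, else $I_{N+m}(\gamma)=0$. Set $\mathcal R_s(\gamma)=\sum_m\big[r_{N+m}(\gamma)+I_{N+m}(\gamma)(r'_{N+m}(\gamma)-r_{N+m}(\gamma))\big]$. Part 2. Let $\hat\alpha_n(p)$ be $\alpha_n(p)$ rounded to the nearest integer multiple of $1/K$. Solve by backward induction $V_{N+1}(\gamma)=\mathcal R_s(\gamma)$, $V_n(\gamma)=\max_{p_n\in\Omega_c}[\alpha_n(p_n)p_n+V_{n+1}(\gamma+\hat\alpha_n(p_n))]$. Output the optimal decisions retrieved along the optimality equations starting from $V_1(0)$, together with the supportive decisions attaining $\mathcal R_s$ at the terminal $\gamma$. **UCB-Add-On algorithm** (parameter $\varepsilon$). It maintains, initialized at $0$: counters $c_n(p)$ and $c_{N+m}(p)$, the numbers of periods in which price $p$ has been used for core product $n$ (resp. supportive product $m$); $c^{(a,1)}_{N+m}(p')$, the number of core products purchased when supportive product $m$ is selected for add-on discount at discount price $p'$; $c^{(a,2)}_{N+m}(p)$, the number of core products purchased when supportive product $m$ is not selected for add-on discount and is offered at original price $p$; and the corresponding empirical averages of the demand parameters. Time is divided into episodes. At the first period $t$ of episode $\tau$, for every parameter it forms $\min\big(1,\ \text{empirical average}+\sqrt{2\log t/\text{counter}}\big)$ (equal to $1$ when the counter is $0$), and runs the Discretized DP Algorithm with these values as demand functions and $K=\lceil\sqrt t/\varepsilon\rceil$, obtaining policy $\Pi_\tau$. It keeps using $\Pi_\tau$, updating the averages and counters in each period,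 and terminates the episode when the value of at least one of the counters associated with the selected add-on products and prices under $\Pi_\tau$ is doubled within the episode. -}

module Defs where

open import Level using (Level; _⊔_) renaming (suc to lsuc)
open import Algebra.Bundles using (CommutativeRing)
open import Data.Bool using (Bool; true; false; _∨_; if_then_else_)
open import Data.Fin using (Fin; zero; suc)
open import Data.Fin.Subset using (Subset; ∣_∣)
open import Data.List using (List; []; _∷_)
open import Data.Nat as ℕ using (ℕ; zero; suc)
open import Data.Product using (∃; _×_; _,_)
open import Data.Sum using ([_,_]′)
open import Data.Vec using (Vec; []; _∷_; _++_; foldr′; lookup)
open import Function using (_∘_)
open import Relation.Binary.Core using (Rel)
open import Relation.Binary.PropositionalEquality using (_≡_)
open import Relation.Binary.Structures using (IsDecTotalOrder)
open import Relation.Nullary using (¬_)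
import Algebra.Properties.CommutativeMonoid.Sum as Sum
import Algebra.Properties.Semiring.Mult as Mult
import Relation.Binary.Construct.NonStrictToStrict as Strict

-- Totally ordered fields with square roots of nonnegative elements. These are
-- the only properties of ℝ that the development uses, and ℝ is the intended
-- model.  The value of √ at negative elements is unconstrained.
record EuclideanField (c ℓ₁ ℓ₂ : Level) : Set (lsuc (c ⊔ ℓ₁ ⊔ ℓ₂)) where
  infix 4 _≤_
  field
    commutativeRing : CommutativeRing c ℓ₁
  open CommutativeRing commutativeRing public
  field
    _≤_             : Rel Carrier ℓ₂
    isDecTotalOrder : IsDecTotalOrder _≈_ _≤_
    +-monoˡ-≤       : ∀ z {x y} → x ≤ y → (x + z) ≤ (y + z)
    *-nonNeg        : ∀ {x y} → 0# ≤ x → 0# ≤ y → 0# ≤ (x * y)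
    1≉0             : ¬ (1# ≈ 0#)
    inverse         : ∀ x → ¬ (x ≈ 0#) → ∃ λ y → x * y ≈ 1#
    √_              : Carrier → Carrier
    √-nonNeg        : ∀ {x} → 0# ≤ x → 0# ≤ √ x
    √-square        : ∀ {x} → 0# ≤ x → √ x * √ x ≈ x

  open Strict _≈_ _≤_ public using (_<_)
  open Sum +-commutativeMonoid public using (sum)
  open Mult semiring using () renaming (_×_ to _×ℕ_)

  fromℕ : ℕ → Carrier
  fromℕ n = n ×ℕ 1#

module AddOnDiscount {c ℓ₁ ℓ₂} (F : EuclideanField c ℓ₁ ℓ₂) where
  open EuclideanField F hiding (zero)

  IsMaximum IsMinimum : ∀ {a} {A : Set a} → (A → Carrier) → Carrier → Set (a ⊔ ℓ₁ ⊔ ℓ₂)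
  IsMaximum f r = (∃ λ a → f a ≈ r) × (∀ a → f a ≤ r)
  IsMinimum f r = (∃ λ a → f a ≈ r) × (∀ a → r ≤ f a)

  Probability : Carrier → Set ℓ₂
  Probability x = (0# ≤ x) × (x ≤ 1#)

  -- Probability laws are represented by their expectation functionals.

  𝔼-bernoulli : Carrier → (Bool → Carrier) → Carrier
  𝔼-bernoulli q f = q * f true + (1# - q) * f false

  𝔼-bernoullis : ∀ {n} → (Fin n → Carrier) → (Vec Bool n → Carrier) → Carrier
  𝔼-bernoullis {zero}  q f = f []
  𝔼-bernoullis {suc n} q f =
    𝔼-bernoulli (q zero) λ b → 𝔼-bernoullis (q ∘ suc) λ bs → f (b ∷ bs)

  record FiniteLaw {a} (A : Set a) : Set (a ⊔ c ⊔ ℓ₁ ⊔ ℓ₂) where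
    field
      arity      : ℕ
      outcome    : Fin arity → A
      weight     : Fin arity → Carrier
      weight≥0   : ∀ i → 0# ≤ weight i
      sumWeights : sum weight ≈ 1#

  𝔼 : ∀ {a} {A : Set a} → FiniteLaw A → (A → Carrier) → Carrier
  𝔼 μ f = sum λ i → weight i * f (outcome i)
    where open FiniteLaw μ

  -- A nonempty finite set of nonnegative prices, enumerated without repetition;
  -- a price in the set is referred to by its index.
  record PriceSet : Set (c ⊔ ℓ₁ ⊔ ℓ₂) where
    field
      size     : ℕ
      nonEmpty : ℕ.NonZero size
      price    : Fin size → Carrier
      nonNeg   : ∀ i → 0# ≤ price i
      distinct : ∀ i j → price i ≈ price j → i ≡ j
  open PriceSet public

  -- The part of a problem instance that is known to the seller.
  record Market (N M : ℕ) : Set (c ⊔ ℓ₁ ⊔ ℓ₂) where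
    field
      Ωc Ωs Ωa   : PriceSet
      spaceLimit : ℕ
      -- Equivalent to the existence of a feasible policy (when M ≥ 1), hence
      -- needed for the optimal revenue to be defined; without it there would
      -- also be no learning algorithm to quantify over.
      feasible   : ∃ λ j → ∃ λ k → price Ωa k < price Ωs j

    IsHighestPrice : Carrier → Set (ℓ₁ ⊔ ℓ₂)
    IsHighestPrice = IsMaximum [ price Ωc , price Ωs ]′

    maxSize : ℕ
    maxSize = size Ωc ℕ.⊔ size Ωs ℕ.⊔ size Ωa

  module _ {N M : ℕ} (𝓜 : Market N M) where
    open Market 𝓜

    record FeasiblePolicy : Set (ℓ₁ ⊔ ℓ₂) where
      field
        core     : Fin N → Fin (size Ωc)
        supp     : Fin M → Fin (size Ωs)
        discount : Fin M → Fin (size Ωa)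
        selected : Subset M
        space    : ∣ selected ∣ ℕ.≤ spaceLimit
        cheaper  : ∀ m → price Ωa (discount m) < price Ωs (supp m)

    -- αc n, αs m, β m, β′ m are αₙ, α_{N+m}, β_{N+m}, β′_{N+m}.
    record Demand : Set (c ⊔ ℓ₂) where
      field
        αc      : Fin N → Fin (size Ωc) → Carrier
        αs β    : Fin M → Fin (size Ωs) → Carrier
        β′      : Fin M → Fin (size Ωa) → Carrier
        αc-prob : ∀ n i → Probability (αc n i)
        αs-prob : ∀ m j → Probability (αs m j)
        β-prob  : ∀ m j → Probability (β m j)
        β′-prob : ∀ m k → Probability (β′ m k)

    module _ (D : Demand) where
      open Demand D

      revenue : FeasiblePolicy → Carrier
      revenue Π =
        sum (λ n → αc n (core n) * price Ωc (core n))
        + sum (λ m → αs m (supp m) * price Ωs (supp m))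
        + sum (λ n → αc n (core n))
          * sum (λ m → I m * β′ m (discount m) * price Ωa (discount m)
                       + (1# - I m) * β m (supp m) * price Ωs (supp m))
        where
        open FeasiblePolicy Π
        I : Fin M → Carrier
        I m = if lookup selected m then 1# else 0#

      addOnProb : FeasiblePolicy → Fin M → Carrier
      addOnProb Π m = if lookup selected m then β′ m (discount m) else β m (supp m)
        where open FeasiblePolicy Π

    -- The purchases of one period. Row n of addOn holds the add-on purchases of
    -- the customer of core product n; it is false throughout if there is none.
    record Purchases : Set where
      constructor purchases
      field
        core  : Vec Bool N
        supp  : Vec Bool M
        addOn : Vec (Vec Bool M) N

    𝔼-addOns : ∀ {n} → (Fin M → Carrier) → Vec Bool n → (Vec (Vec Bool M) n → Carrier) → Carrier
    𝔼-addOns q []       f = f []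
    𝔼-addOns q (b ∷ bs) f =
      𝔼-bernoullis (λ m → if b then q m else 0#) λ row → 𝔼-addOns q bs λ rows → f (row ∷ rows)

    𝔼-primary : Demand → FeasiblePolicy → (Vec Bool N → Vec Bool M → Carrier) → Carrier
    𝔼-primary D Π f =
      𝔼-bernoullis (λ n → αc n (core n)) λ xs →
      𝔼-bernoullis (λ m → αs m (supp m)) λ ys → f xs ys
      where
      open Demand D
      open FeasiblePolicy Π

    𝔼-purchases : Demand → FeasiblePolicy → (Purchases → Carrier) → Carrier
    𝔼-purchases D Π f =
      𝔼-primary D Π λ xs ys →
      𝔼-addOns (addOnProb D Π) xs λ zs → f (purchases xs ys zs)

    -- λ is the minimum of this over all policies.
    ℙ-nonzeroPrimary : Demand → FeasiblePolicy → Carrier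
    ℙ-nonzeroPrimary D Π = 𝔼-primary D Π λ xs ys →
      if foldr′ _∨_ false (xs ++ ys) then 1# else 0#

    -- Past policies with the resulting purchases, most recent period first.
    History : Set (ℓ₁ ⊔ ℓ₂)
    History = List (FeasiblePolicy × Purchases)

    -- Possibly randomised. There are only finitely many policies, so finite
    -- laws are no restriction; deterministic algorithms have arity 1. Since 𝓜
    -- is fixed but no Demand is given, only the latter is unknown.
    Algorithm : Set (c ⊔ ℓ₁ ⊔ ℓ₂)
    Algorithm = History → FiniteLaw FeasiblePolicy

    module _ (D : Demand) (R* : Carrier) (𝓐 : Algorithm) where

      -- Conditional expectation, given the history so far, of the regret
      -- incurred in the next T periods.
      regretFrom : History → ℕ → Carrier
      regretFrom h zero    = 0#
      regretFrom h (suc T) = 𝔼 (𝓐 h) λ Π →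
        (R* - revenue D Π) + 𝔼-purchases D Π (λ o → regretFrom ((Π , o) ∷ h) T)

      regret : ℕ → Carrier
      regret = regretFrom []

{-# OPTIONS --safe #-}

-- With S = 0, α_{N+m} = 0 and β_{N+m} = 1, selling a core product at price p
-- earns p + M p̂ in expectation, so each core product is a separate bandit
-- problem whose arms are the U core prices. Baseline purchase probabilities
-- are chosen to make all prices equally profitable; for each core product the
-- probability at one hidden price is then raised by the factor 1 + ε, where
-- ε = √(U T) / (4 T).
--
-- Fix a core product and give weight w i ≥ 0 to the instance whose hidden
-- price is i. One period multiplies the weight of the price in use by a random
-- factor of mean 1, so under the baseline law the weights are martingales that
-- move only when their price is used. The potential Φ(w) = (2w - 1)² / (w + 1)
-- satisfies 4w ≤ 8 + Φ(w), and its expected growth per period is at most 9 ε²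
-- because Φ is linear in w up to a resolvent 9 / (w + 1) of bounded curvature.
-- Induction on T bounds the weighted number of periods in which the hidden
-- price is used. Starting from w = 2, at least T / 32 periods miss it on
-- average over its U positions. Averaging over the hidden prices of all core
-- products gives one instance that is bad for the algorithm.

module Submission where

open import Defs
import Algebra.Properties.Ring as RingProperties
import Algebra.Properties.Semiring.Mult.TCOptimised as Mult
import Algebra.Properties.Semiring.Sum as Sum
import Algebra.Solver.Ring as RingSolver
open import Algebra.Solver.Ring.AlmostCommutativeRing using (fromCommutativeRing; _-Raw-AlmostCommutative⟶_)
open import Data.Bool using (Bool; true; false; if_then_else_; _∨_)
open import Data.Fin as Fin using (Fin; zero; suc; punchIn; toℕ)
open import Data.Fin.Properties using (punchInᵢ≢i; toℕ-injective; toℕ<n)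
open import Data.Fin.Subset using (Subset; ∣_∣; ⊥)
open import Data.Fin.Subset.Properties using (∣⊥∣≡0)
open import Data.Integer as ℤ using (ℤ; +_; -[1+_]; _⊖_)
import Data.Integer.Properties as ℤ
open import Data.List using ([]; _∷_)
open import Data.Maybe using (Maybe; just; nothing)
open import Data.Nat as ℕ using (ℕ; zero; suc)
import Data.Nat.Properties as ℕ
open import Data.Product using (Σ-syntax; ∃; ∃-syntax; _×_; _,_; proj₁; proj₂)
open import Data.Sum using (inj₁; inj₂)
open import Data.Vec as Vec using (Vec; []; _∷_; insertAt; lookup; foldr′; _[_]≔_)
open import Data.Vec.Properties using (lookup∘update; lookup∘update′)
open import Function using (_∘_)
open import Level using (Level; _⊔_)
open import Relation.Binary.Bundles using (DecTotalOrder)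
open import Relation.Binary.Definitions using (tri<; tri≈; tri>)
open import Relation.Binary.PropositionalEquality as ≡ using (_≡_)
open import Relation.Nullary using (¬_; yes; no; does; contradiction)

-- Numerals, inequalities and finite sums in an ordered field.

module FieldProperties {c ℓ₁ ℓ₂} (F : EuclideanField c ℓ₁ ℓ₂) where
  open EuclideanField F hiding (zero)
  open RingProperties ring
    using (-‿distribˡ-*; -‿distribʳ-*; -‿involutive; -0#≈0#; -‿+-comm)
  private module × = Mult semiring
  open Sum semiring public
    using (sum-cong-≋; ∑-distrib-+; ∑-comm; *-distribˡ-sum; *-distribʳ-sum)

  decTotalOrder : DecTotalOrder c ℓ₁ ℓ₂
  decTotalOrder = record { isDecTotalOrder = isDecTotalOrder }

  open DecTotalOrder decTotalOrder public
    using (_≟_; poset; total; antisym)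
    renaming (refl to ≤-refl; trans to ≤-trans; reflexive to ≤-reflexive)
  open import Relation.Binary.Reasoning.PartialOrder poset public

  -- Unlike fromℕ 1, the numeral # 1 is definitionally 1#, and # n is how the
  -- ring solver evaluates con (+ n).

  infix 10 #_
  #_ : ℕ → Carrier
  # n = n ×.× 1#

  fromℤ : ℤ → Carrier
  fromℤ (+ n)    = # n
  fromℤ -[1+ n ] = - (# suc n)

  fromℕ≈# : ∀ n → fromℕ n ≈ # n
  fromℕ≈# n = ×.×ᵤ≈× n 1#

  private
    #-suc : ∀ n → # suc n ≈ 1# + # n
    #-suc n = ×.1+× n 1#

    fromℤ-⊖ : ∀ m n → fromℤ (m ⊖ n) ≈ # m - # n
    fromℤ-⊖ zero    zero    = sym (-‿inverseʳ 0#)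
    fromℤ-⊖ zero    (suc n) = sym (+-identityˡ _)
    fromℤ-⊖ (suc m) zero    = sym (trans (+-congˡ -0#≈0#) (+-identityʳ _))
    fromℤ-⊖ (suc m) (suc n) = begin-equality
      fromℤ (suc m ⊖ suc n)          ≡⟨ ≡.cong fromℤ (ℤ.[1+m]⊖[1+n]≡m⊖n m n) ⟩
      fromℤ (m ⊖ n)                  ≈⟨ fromℤ-⊖ m n ⟩
      # m - # n                      ≈⟨ +-congˡ (+-identityˡ _) ⟨
      # m + (0# - # n)               ≈⟨ +-congˡ (+-congʳ (-‿inverseʳ 1#)) ⟨
      # m + ((1# - 1#) - # n)        ≈⟨ +-congˡ (+-assoc _ _ _) ⟩
      # m + (1# + (- 1# - # n))      ≈⟨ +-assoc _ _ _ ⟨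
      # m + 1# + (- 1# - # n)        ≈⟨ +-cong (+-comm _ _) (-‿+-comm _ _) ⟩
      1# + # m - (1# + # n)          ≈⟨ +-cong (#-suc m) (-‿cong (#-suc n)) ⟨
      # suc m - # suc n              ∎

    fromℤ-neg : ∀ i → fromℤ (ℤ.- i) ≈ - fromℤ i
    fromℤ-neg (+ zero)   = sym -0#≈0#
    fromℤ-neg (+ suc n)  = refl
    fromℤ-neg -[1+ n ]   = sym (-‿involutive _)

    fromℤ-+ : ∀ i j → fromℤ (i ℤ.+ j) ≈ fromℤ i + fromℤ j
    fromℤ-+ (+ m)    (+ n)    = ×.×-homo-+ 1# m n
    fromℤ-+ (+ m)    -[1+ n ] = fromℤ-⊖ m (suc n)
    fromℤ-+ -[1+ m ] (+ n)    = trans (fromℤ-⊖ n (suc m)) (+-comm _ _)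
    fromℤ-+ -[1+ m ] -[1+ n ] = begin-equality
      - (# suc (suc (m ℕ.+ n)))      ≡⟨ ≡.cong (λ k → - (# suc k)) (ℕ.+-suc m n) ⟨
      - (# (suc m ℕ.+ suc n))        ≈⟨ -‿cong (×.×-homo-+ 1# (suc m) (suc n)) ⟩
      - (# suc m + # suc n)          ≈⟨ -‿+-comm _ _ ⟨
      - (# suc m) - # suc n          ∎

    fromℤ-pos-* : ∀ m j → fromℤ (+ m ℤ.* j) ≈ # m * fromℤ j
    fromℤ-pos-* m (+ n) = begin-equality
      fromℤ (+ m ℤ.* + n)   ≡⟨ ≡.cong fromℤ (ℤ.pos-* m n) ⟨
      # (m ℕ.* n)           ≈⟨ ×.×1-homo-* m n ⟩
      # m * # n             ∎
    fromℤ-pos-* m -[1+ n ] = begin-equality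
      fromℤ (+ m ℤ.* (ℤ.- (+ suc n)))  ≡⟨ ≡.cong fromℤ (ℤ.neg-distribʳ-* (+ m) (+ suc n)) ⟨
      fromℤ (ℤ.- (+ m ℤ.* + suc n))    ≈⟨ fromℤ-neg (+ m ℤ.* + suc n) ⟩
      - fromℤ (+ m ℤ.* + suc n)        ≈⟨ -‿cong (fromℤ-pos-* m (+ suc n)) ⟩
      - (# m * # suc n)                ≈⟨ -‿distribʳ-* _ _ ⟩
      # m * - (# suc n)                ∎

    fromℤ-* : ∀ i j → fromℤ (i ℤ.* j) ≈ fromℤ i * fromℤ j
    fromℤ-* (+ m)    j = fromℤ-pos-* m j
    fromℤ-* -[1+ m ] j = begin-equality
      fromℤ ((ℤ.- (+ suc m)) ℤ.* j)  ≡⟨ ≡.cong fromℤ (ℤ.neg-distribˡ-* (+ suc m) j) ⟨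
      fromℤ (ℤ.- (+ suc m ℤ.* j))    ≈⟨ fromℤ-neg (+ suc m ℤ.* j) ⟩
      - fromℤ (+ suc m ℤ.* j)        ≈⟨ -‿cong (fromℤ-pos-* (suc m) j) ⟩
      - (# suc m * fromℤ j)          ≈⟨ -‿distribˡ-* _ _ ⟩
      - (# suc m) * fromℤ j          ∎

    -- Lets the ring solver compute with integer coefficients, whose equality is decided by
    -- evaluation, so that identities containing numerals close by `refl`.
    fromℤ-morphism : ℤ.+-*-rawRing -Raw-AlmostCommutative⟶ fromCommutativeRing commutativeRing
    fromℤ-morphism = record
      { ⟦_⟧    = fromℤ
      ; +-homo = fromℤ-+
      ; *-homo = fromℤ-*
      ; -‿homo = fromℤ-neg
      ; 0-homo = refl
      ; 1-homo = refl
      }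

    fromℤ-≟ : ∀ i j → Maybe (fromℤ i ≈ fromℤ j)
    fromℤ-≟ i j with i ℤ.≟ j
    ... | yes i≡j = just (reflexive (≡.cong fromℤ i≡j))
    ... | no  _   = nothing

  open RingSolver ℤ.+-*-rawRing (fromCommutativeRing commutativeRing) fromℤ-morphism fromℤ-≟ public
    using (solve; _:=_; _:+_; _:*_; _:-_; :-_; con)

  -- Order

  ≤-respˡ : ∀ {x y z} → x ≈ y → x ≤ z → y ≤ z
  ≤-respˡ x≈y = ≤-trans (≤-reflexive (sym x≈y))

  ≤-respʳ : ∀ {x y z} → y ≈ z → x ≤ y → x ≤ z
  ≤-respʳ y≈z x≤y = ≤-trans x≤y (≤-reflexive y≈z)

  +-monoʳ-≤ : ∀ z {x y} → x ≤ y → z + x ≤ z + y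
  +-monoʳ-≤ z {x} {y} x≤y = begin
    z + x ≈⟨ +-comm z x ⟩
    x + z ≤⟨ +-monoˡ-≤ z x≤y ⟩
    y + z ≈⟨ +-comm y z ⟩
    z + y ∎

  +-mono-≤ : ∀ {x y u v} → x ≤ y → u ≤ v → x + u ≤ y + v
  +-mono-≤ {y = y} {u} x≤y u≤v = ≤-trans (+-monoˡ-≤ u x≤y) (+-monoʳ-≤ y u≤v)

  +-nonNeg : ∀ {x y} → 0# ≤ x → 0# ≤ y → 0# ≤ x + y
  +-nonNeg 0≤x 0≤y = ≤-respˡ (+-identityˡ 0#) (+-mono-≤ 0≤x 0≤y)

  ≤-by-difference : ∀ {x y d} → 0# ≤ d → x + d ≈ y → x ≤ y
  ≤-by-difference {x} {y} {d} 0≤d x+d≈y = begin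
    x      ≈⟨ +-identityʳ x ⟨
    x + 0# ≤⟨ +-monoʳ-≤ x 0≤d ⟩
    x + d  ≈⟨ x+d≈y ⟩
    y      ∎

  x≤y⇒0≤y-x : ∀ {x y} → x ≤ y → 0# ≤ y - x
  x≤y⇒0≤y-x {x} {y} x≤y = ≤-respˡ (-‿inverseʳ x) (+-monoˡ-≤ (- x) x≤y)

  neg-antimono-≤ : ∀ {x y} → x ≤ y → - y ≤ - x
  neg-antimono-≤ {x} {y} x≤y = ≤-by-difference (x≤y⇒0≤y-x x≤y)
    (solve 2 (λ x y → :- y :+ (y :- x) := :- x) refl x y)

  *-monoˡ-≤ : ∀ {z x y} → 0# ≤ z → x ≤ y → z * x ≤ z * y
  *-monoˡ-≤ {z} {x} {y} 0≤z x≤y = ≤-by-difference (*-nonNeg 0≤z (x≤y⇒0≤y-x x≤y))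
    (solve 3 (λ z x y → z :* x :+ z :* (y :- x) := z :* y) refl z x y)

  *-monoʳ-≤ : ∀ {z x y} → 0# ≤ z → x ≤ y → x * z ≤ y * z
  *-monoʳ-≤ {z} {x} {y} 0≤z x≤y = ≤-respˡ (*-comm z x) (≤-respʳ (*-comm z y) (*-monoˡ-≤ 0≤z x≤y))

  x≤0⇒0≤-x : ∀ {x} → x ≤ 0# → 0# ≤ - x
  x≤0⇒0≤-x x≤0 = ≤-respʳ (+-identityˡ _) (x≤y⇒0≤y-x x≤0)

  square-nonNeg : ∀ x → 0# ≤ x * x
  square-nonNeg x with total 0# x
  ... | inj₁ 0≤x = *-nonNeg 0≤x 0≤x
  ... | inj₂ x≤0 = ≤-respʳ (solve 1 (λ x → :- x :* :- x := x :* x) refl x)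
    (*-nonNeg (x≤0⇒0≤-x x≤0) (x≤0⇒0≤-x x≤0))

  0≤1 : 0# ≤ 1#
  0≤1 = ≤-respʳ (*-identityˡ 1#) (square-nonNeg 1#)

  fromℕ-nonNeg : ∀ n → 0# ≤ fromℕ n
  fromℕ-nonNeg zero    = ≤-refl
  fromℕ-nonNeg (suc n) = +-nonNeg 0≤1 (fromℕ-nonNeg n)

  #-nonNeg : ∀ n → 0# ≤ # n
  #-nonNeg n = ≤-respʳ (fromℕ≈# n) (fromℕ-nonNeg n)

  fromℕ-mono-≤ : ∀ {m n} → m ℕ.≤ n → fromℕ m ≤ fromℕ n
  fromℕ-mono-≤ {n = n} ℕ.z≤n     = fromℕ-nonNeg n
  fromℕ-mono-≤         (ℕ.s≤s p) = +-monoʳ-≤ 1# (fromℕ-mono-≤ p)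

  fromℕ-* : ∀ m n → fromℕ (m ℕ.* n) ≈ fromℕ m * fromℕ n
  fromℕ-* m n = begin-equality
    fromℕ (m ℕ.* n)    ≈⟨ fromℕ≈# (m ℕ.* n) ⟩
    # (m ℕ.* n)        ≈⟨ ×.×1-homo-* m n ⟩
    # m * # n          ≈⟨ *-cong (fromℕ≈# m) (fromℕ≈# n) ⟨
    fromℕ m * fromℕ n  ∎

  1≰0 : ¬ (1# ≤ 0#)
  1≰0 1≤0 = 1≉0 (antisym 1≤0 0≤1)

  1≤fromℕ-suc : ∀ n → 1# ≤ fromℕ (suc n)
  1≤fromℕ-suc n = ≤-by-difference (fromℕ-nonNeg n) refl

  ≥1⇒≉0 : ∀ {x} → 1# ≤ x → ¬ (x ≈ 0#)
  ≥1⇒≉0 1≤x x≈0 = 1≰0 (≤-respʳ x≈0 1≤x)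

  inverse-nonNeg : ∀ {x y} → 0# ≤ x → x * y ≈ 1# → 0# ≤ y
  inverse-nonNeg {x} {y} 0≤x xy≈1 with total 0# y
  ... | inj₁ 0≤y = 0≤y
  ... | inj₂ y≤0 = contradiction
    (≤-by-difference (*-nonNeg 0≤x (x≤0⇒0≤-x y≤0))
      (trans (+-congʳ (sym xy≈1)) (solve 2 (λ x y → x :* y :+ x :* :- y := con (+ 0)) refl x y)))
    1≰0

  -- The invertible factor comes with its inverse as a witness. Throughout, such witnesses stand in
  -- for division, which would need a proof of nonzeroness at every use.
  unit-cancelˡ : ∀ {x y u v} → x * y ≈ 1# → x * u ≈ x * v → u ≈ v
  unit-cancelˡ {x} {y} {u} {v} xy≈1 xu≈xv = begin-equality
    u             ≈⟨ *-identityˡ u ⟨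
    1# * u        ≈⟨ *-congʳ xy≈1 ⟨
    x * y * u     ≈⟨ solve 3 (λ x y u → x :* y :* u := y :* (x :* u)) refl x y u ⟩
    y * (x * u)   ≈⟨ *-congˡ xu≈xv ⟩
    y * (x * v)   ≈⟨ solve 3 (λ x y u → y :* (x :* u) := x :* y :* u) refl x y v ⟩
    x * y * v     ≈⟨ *-congʳ xy≈1 ⟩
    1# * v        ≈⟨ *-identityˡ v ⟩
    v             ∎

  unit-cancelˡ-≤ : ∀ {x y u v} → 0# ≤ x → x * y ≈ 1# → x * u ≤ x * v → u ≤ v
  unit-cancelˡ-≤ {x} {y} {u} {v} 0≤x xy≈1 xu≤xv = begin
    u             ≈⟨ *-identityˡ u ⟨
    1# * u        ≈⟨ *-congʳ xy≈1 ⟨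
    x * y * u     ≈⟨ solve 3 (λ x y u → x :* y :* u := y :* (x :* u)) refl x y u ⟩
    y * (x * u)   ≤⟨ *-monoˡ-≤ (inverse-nonNeg 0≤x xy≈1) xu≤xv ⟩
    y * (x * v)   ≈⟨ solve 3 (λ x y u → y :* (x :* u) := x :* y :* u) refl x y v ⟩
    x * y * v     ≈⟨ *-congʳ xy≈1 ⟩
    1# * v        ≈⟨ *-identityˡ v ⟩
    v             ∎

  -- Only `y ≤ x` needs work. If `x - y` is nonzero, cancelling it from `(x - y) * (x + y) ≤ 0#`
  -- leaves `x + y ≤ 0#`, which forces `x ≤ 0#` and so `x ≤ y`.
  square-cancel-≤ : ∀ {x y} → 0# ≤ x → 0# ≤ y → x * x ≤ y * y → x ≤ y
  square-cancel-≤ {x} {y} 0≤x 0≤y x²≤y² with total x y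
  ... | inj₁ x≤y = x≤y
  ... | inj₂ y≤x with x - y ≟ 0#
  ...   | yes x-y≈0 = ≤-reflexive (trans (solve 2 (λ x y → x := y :+ (x :- y)) refl x y)
            (trans (+-congˡ x-y≈0) (+-identityʳ y)))
  ...   | no  x-y≉0 = let z , dz≈1 = inverse (x - y) x-y≉0 in begin
    x         ≤⟨ ≤-by-difference 0≤y refl ⟩
    x + y     ≤⟨ unit-cancelˡ-≤ (x≤y⇒0≤y-x y≤x) dz≈1 (begin
      (x - y) * (x + y)  ≈⟨ solve 2 (λ x y → (x :- y) :* (x :+ y) := x :* x :- y :* y) refl x y ⟩
      x * x - y * y      ≤⟨ +-monoˡ-≤ (- (y * y)) x²≤y² ⟩
      y * y - y * y      ≈⟨ solve 2 (λ x y → y :* y :- y :* y := (x :- y) :* con (+ 0)) refl x y ⟩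
      (x - y) * 0#       ∎) ⟩
    0#        ≤⟨ 0≤y ⟩
    y         ∎

  -- Sums

  sum-mono-≤ : ∀ {n} {f g : Fin n → Carrier} → (∀ i → f i ≤ g i) → sum f ≤ sum g
  sum-mono-≤ {zero}  f≤g = ≤-refl
  sum-mono-≤ {suc n} f≤g = +-mono-≤ (f≤g zero) (sum-mono-≤ (f≤g ∘ suc))

  sum-nonNeg : ∀ {n} {f : Fin n → Carrier} → (∀ i → 0# ≤ f i) → 0# ≤ sum f
  sum-nonNeg {zero}  0≤f = ≤-refl
  sum-nonNeg {suc n} 0≤f = +-nonNeg (0≤f zero) (sum-nonNeg (0≤f ∘ suc))

  term≤sum : ∀ {n} {f : Fin n → Carrier} → (∀ i → 0# ≤ f i) → ∀ i → f i ≤ sum f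
  term≤sum 0≤f zero    = ≤-by-difference (sum-nonNeg (0≤f ∘ suc)) refl
  term≤sum 0≤f (suc i) = ≤-trans (term≤sum (0≤f ∘ suc) i)
    (≤-by-difference (0≤f zero) (+-comm _ _))

  sum-const : ∀ n x → sum {n} (λ _ → x) ≈ fromℕ n * x
  sum-const zero    x = sym (zeroˡ x)
  sum-const (suc n) x = trans (+-congˡ (sum-const n x))
    (solve 2 (λ n x → x :+ n :* x := (con (+ 1) :+ n) :* x) refl (fromℕ n) x)

  sum-linear : ∀ {n} (w f g : Fin n → Carrier) →
               sum (λ i → w i * (f i + g i)) ≈ sum (λ i → w i * f i) + sum (λ i → w i * g i)
  sum-linear w f g = trans (sum-cong-≋ (λ i → distribˡ (w i) (f i) (g i)))
    (∑-distrib-+ (λ i → w i * f i) (λ i → w i * g i))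

  sum-combination : ∀ {n} x y (f g : Fin n → Carrier) →
                    x * sum f + y * sum g ≈ sum (λ i → x * f i + y * g i)
  sum-combination x y f g = trans (+-cong (*-distribˡ-sum x f) (*-distribˡ-sum y g))
    (sym (∑-distrib-+ (λ i → x * f i) (λ i → y * g i)))

  -- If the first term lies below `x`, removing it leaves the average of the others at least `x`.
  sum-average : ∀ {n} (f : Fin (suc n) → Carrier) x → fromℕ (suc n) * x ≤ sum f → ∃[ i ] x ≤ f i
  sum-average {zero} f x p = zero , (begin
    x               ≈⟨ solve 1 (λ x → x := (con (+ 1) :+ con (+ 0)) :* x) refl x ⟩
    (1# + 0#) * x   ≤⟨ p ⟩
    f zero + 0#     ≈⟨ +-identityʳ _ ⟩
    f zero          ∎)
  sum-average {suc n} f x p with total x (f zero)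
  ... | inj₁ x≤f0 = zero , x≤f0
  ... | inj₂ f0≤x = let i , x≤fi = sum-average (f ∘ suc) x tail-bound in suc i , x≤fi
    where
    tail-bound : fromℕ (suc n) * x ≤ sum (f ∘ suc)
    tail-bound = begin
      fromℕ (suc n) * x             ≈⟨ solve 2 (λ n x → n :* x := :- x :+ (con (+ 1) :+ n) :* x) refl (fromℕ (suc n)) x ⟩
      - x + fromℕ (suc (suc n)) * x ≤⟨ +-monoʳ-≤ (- x) p ⟩
      - x + (f zero + sum (f ∘ suc)) ≤⟨ +-monoʳ-≤ (- x) (+-monoˡ-≤ _ f0≤x) ⟩
      - x + (x + sum (f ∘ suc))     ≈⟨ solve 2 (λ x y → :- x :+ (x :+ y) := y) refl x (sum (f ∘ suc)) ⟩
      sum (f ∘ suc)                 ∎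

  argmin⁺ : ∀ {n} (f : Fin (suc n) → Carrier) → ∃[ i ] ∀ j → f i ≤ f j
  argmin⁺ {zero}  f = zero , λ { zero → ≤-refl }
  argmin⁺ {suc n} f with argmin⁺ (f ∘ suc)
  ... | i , least with total (f zero) (f (suc i))
  ...   | inj₁ f0≤ = zero  , λ { zero → ≤-refl ; (suc j) → ≤-trans f0≤ (least j) }
  ...   | inj₂ ≤f0 = suc i , λ { zero → ≤f0    ; (suc j) → least j }

  argmin : ∀ {n} .{{_ : ℕ.NonZero n}} (f : Fin n → Carrier) → ∃[ i ] ∀ j → f i ≤ f j
  argmin {suc n} = argmin⁺

-- Expectation functionals and conditioning.

module Expectation {c ℓ₁ ℓ₂} (F : EuclideanField c ℓ₁ ℓ₂) where
  open EuclideanField F hiding (zero)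
  open FieldProperties F
  open AddOnDiscount F

  private variable
    a b : Level
    A : Set a
    B : Set b

  -- A positive normalised linear functional. These properties survive pushforward and sequencing,
  -- so multi-stage laws are handled without a sample space.
  record IsExpectation {a} {A : Set a} (E : (A → Carrier) → Carrier) : Set (a ⊔ c ⊔ ℓ₁ ⊔ ℓ₂) where
    field
      mono  : ∀ {f g} → (∀ x → f x ≤ g x) → E f ≤ E g
      add   : ∀ f g → E (λ x → f x + g x) ≈ E f + E g
      scale : ∀ z f → E (λ x → z * f x) ≈ z * E f
      const : ∀ z → E (λ _ → z) ≈ z

    -- Not a field, because monotonicity in both directions and antisymmetry give it.
    cong : ∀ {f g} → (∀ x → f x ≈ g x) → E f ≈ E g
    cong f≈g = antisym (mono (≤-reflexive ∘ f≈g)) (mono (≤-reflexive ∘ sym ∘ f≈g))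

    linear : ∀ {n} (w : Fin n → Carrier) (f : Fin n → A → Carrier) →
             E (λ x → sum λ i → w i * f i x) ≈ sum (λ i → w i * E (f i))
    linear {zero}  w f = const 0#
    linear {suc n} w f = trans (add _ _) (+-cong (scale _ _) (linear (w ∘ suc) (f ∘ suc)))

    upperBound : ∀ {f z} → (∀ x → f x ≤ z) → E f ≤ z
    upperBound f≤z = ≤-respʳ (const _) (mono f≤z)

    lowerBound : ∀ {f z} → (∀ x → z ≤ f x) → z ≤ E f
    lowerBound z≤f = ≤-respˡ (const _) (mono z≤f)

  open IsExpectation public

  IsExpectation-map : ∀ {E : (A → Carrier) → Carrier} (g : A → B) →
                      IsExpectation E → IsExpectation (λ f → E (f ∘ g))
  IsExpectation-map g e = record
    { mono  = λ f≤g → mono e (f≤g ∘ g)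
    ; add   = λ f f′ → add e (f ∘ g) (f′ ∘ g)
    ; scale = λ z f → scale e z (f ∘ g)
    ; const = const e
    }

  -- A law followed by a Markov kernel. Composing such stages yields the law of a whole period.
  IsExpectation-bind : ∀ {E : (A → Carrier) → Carrier} {K : A → (B → Carrier) → Carrier} →
                       IsExpectation E → (∀ x → IsExpectation (K x)) →
                       IsExpectation (λ f → E (λ x → K x f))
  IsExpectation-bind e k = record
    { mono  = λ f≤g → mono e (λ x → mono (k x) f≤g)
    ; add   = λ f g → trans (cong e (λ x → add (k x) f g)) (add e _ _)
    ; scale = λ z f → trans (cong e (λ x → scale (k x) z f)) (scale e z _)
    ; const = λ z → trans (cong e (λ x → const (k x) z)) (const e z)
    }

  𝔼-isExpectation : (μ : FiniteLaw A) → IsExpectation (𝔼 μ)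
  𝔼-isExpectation μ = record
    { mono  = λ f≤g → sum-mono-≤ (λ i → *-monoˡ-≤ (weight≥0 i) (f≤g (outcome i)))
    ; add   = λ f g → sum-linear weight (f ∘ outcome) (g ∘ outcome)
    ; scale = λ z f → trans
        (sum-cong-≋ (λ i → solve 3 (λ w z x → w :* (z :* x) := z :* (w :* x)) refl (weight i) z (f (outcome i))))
        (sym (*-distribˡ-sum z (λ i → weight i * f (outcome i))))
    ; const = λ z → trans (sym (*-distribʳ-sum z weight)) (trans (*-congʳ sumWeights) (*-identityˡ z))
    }
    where open FiniteLaw μ

  𝔼-bernoulli-isExpectation : ∀ {q} → Probability q → IsExpectation (𝔼-bernoulli q)
  𝔼-bernoulli-isExpectation {q} (0≤q , q≤1) = record
    { mono  = λ f≤g → +-mono-≤ (*-monoˡ-≤ 0≤q (f≤g true)) (*-monoˡ-≤ (x≤y⇒0≤y-x q≤1) (f≤g false))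
    ; add   = λ f g → solve 6
        (λ q p x y u v → q :* (x :+ u) :+ p :* (y :+ v) := q :* x :+ p :* y :+ (q :* u :+ p :* v))
        refl q (1# - q) (f true) (f false) (g true) (g false)
    ; scale = λ z f → solve 5
        (λ q p z x y → q :* (z :* x) :+ p :* (z :* y) := z :* (q :* x :+ p :* y))
        refl q (1# - q) z (f true) (f false)
    ; const = λ z → solve 2 (λ q z → q :* z :+ (con (+ 1) :- q) :* z := z) refl q z
    }

  𝔼-bernoullis-isExpectation : ∀ {n} {q : Fin n → Carrier} → (∀ i → Probability (q i)) →
                               IsExpectation (𝔼-bernoullis q)
  𝔼-bernoullis-isExpectation {zero}  q-prob = record
    { mono  = λ f≤g → f≤g []
    ; add   = λ _ _ → refl
    ; scale = λ _ _ → refl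
    ; const = λ _ → refl
    }
  𝔼-bernoullis-isExpectation {suc n} q-prob = IsExpectation-bind
    (𝔼-bernoulli-isExpectation (q-prob zero))
    (λ b → IsExpectation-map (b ∷_) (𝔼-bernoullis-isExpectation (q-prob ∘ suc)))

  𝔼-bernoulli-cong : ∀ {p q} {f g : Bool → Carrier} → p ≈ q → (∀ b → f b ≈ g b) →
                     𝔼-bernoulli p f ≈ 𝔼-bernoulli q g
  𝔼-bernoulli-cong p≈q f≈g =
    +-cong (*-cong p≈q (f≈g true)) (*-cong (+-congˡ (-‿cong p≈q)) (f≈g false))

  -- Conditioning on coordinate n: all laws that agree with q off n have the
  -- same conditional law.
  𝔼-bernoullis-condition : ∀ {m} (n : Fin (suc m)) (p q : Fin (suc m) → Carrier) →
    (∀ i → p (punchIn n i) ≈ q (punchIn n i)) → ∀ f →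
    𝔼-bernoullis p f ≈
    𝔼-bernoulli (p n) λ b → 𝔼-bernoullis (q ∘ punchIn n) λ bs → f (insertAt bs n b)
  𝔼-bernoullis-condition zero p q p≈q f = 𝔼-bernoulli-cong refl λ b → bernoullis-cong p≈q (f ∘ (b ∷_))
    where
    bernoullis-cong : ∀ {m} {p q : Fin m → Carrier} → (∀ i → p i ≈ q i) → ∀ f →
                      𝔼-bernoullis p f ≈ 𝔼-bernoullis q f
    bernoullis-cong {zero}  p≈q f = refl
    bernoullis-cong {suc m} p≈q f =
      𝔼-bernoulli-cong (p≈q zero) λ b → bernoullis-cong (p≈q ∘ suc) (f ∘ (b ∷_))
  𝔼-bernoullis-condition {suc m} (suc n) p q p≈q f = begin-equality
    𝔼-bernoulli (p zero) (λ b → 𝔼-bernoullis (p ∘ suc) (f ∘ (b ∷_)))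
      ≈⟨ 𝔼-bernoulli-cong (p≈q zero)
           (λ b → 𝔼-bernoullis-condition n (p ∘ suc) (q ∘ suc) (p≈q ∘ suc) (f ∘ (b ∷_))) ⟩
    𝔼-bernoulli (q zero) (λ b → 𝔼-bernoulli (p (suc n)) (λ b′ → G b b′))
      -- Fubini for two independent Bernoulli variables: coordinate `suc n` moves outside coordinate
      -- `zero`.
      ≈⟨ solve 6 (λ x y tt tf ft ff →
           x :* (y :* tt :+ (con (+ 1) :- y) :* tf) :+ (con (+ 1) :- x) :* (y :* ft :+ (con (+ 1) :- y) :* ff)
           := y :* (x :* tt :+ (con (+ 1) :- x) :* ft) :+ (con (+ 1) :- y) :* (x :* tf :+ (con (+ 1) :- x) :* ff))
           refl (q zero) (p (suc n)) (G true true) (G true false) (G false true) (G false false) ⟩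
    𝔼-bernoulli (p (suc n)) (λ b′ → 𝔼-bernoulli (q zero) (λ b → G b b′)) ∎
    where
    G : Bool → Bool → Carrier
    G b b′ = 𝔼-bernoullis (q ∘ suc ∘ punchIn n) λ bs → f (b ∷ insertAt bs n b′)

  -- Purchases of one period and costs accumulated over the horizon.

  module _ {N M : ℕ} (𝓜 : Market N M) where

    𝔼-addOns-isExpectation : ∀ {n} {q : Fin M → Carrier} → (∀ m → Probability (q m)) →
                             (xs : Vec Bool n) → IsExpectation (𝔼-addOns 𝓜 q xs)
    𝔼-addOns-isExpectation q-prob [] = record
      { mono  = λ f≤g → f≤g []
      ; add   = λ _ _ → refl
      ; scale = λ _ _ → refl
      ; const = λ _ → refl
      }
    𝔼-addOns-isExpectation {q = q} q-prob (x ∷ xs) = IsExpectation-bind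
      (𝔼-bernoullis-isExpectation (row-prob x))
      (λ row → IsExpectation-map (row ∷_) (𝔼-addOns-isExpectation q-prob xs))
      where
      row-prob : ∀ x m → Probability (if x then q m else 0#)
      row-prob true  m = q-prob m
      row-prob false m = ≤-refl , 0≤1

    module _ (D : Demand 𝓜) where
      open Demand D
      open FeasiblePolicy

      addOnProb-prob : ∀ Π m → Probability (addOnProb 𝓜 D Π m)
      addOnProb-prob Π m with lookup (selected Π) m
      ... | true  = β′-prob m (discount Π m)
      ... | false = β-prob m (supp Π m)

      -- The rest of a period once the core sales `xs` are known. It reads only `αs`, `β` and `β′`,
      -- so demands that differ in `αc` alone share it.
      𝔼-purchases-givenCore : FeasiblePolicy 𝓜 → (Purchases 𝓜 → Carrier) → Vec Bool N → Carrier
      𝔼-purchases-givenCore Π f xs =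
        𝔼-bernoullis (λ m → αs m (supp Π m)) λ ys →
        𝔼-addOns 𝓜 (addOnProb 𝓜 D Π) xs λ zs → f (purchases xs ys zs)

      𝔼-purchases-givenCore-isExpectation : ∀ Π xs →
        IsExpectation (λ f → 𝔼-purchases-givenCore Π f xs)
      𝔼-purchases-givenCore-isExpectation Π xs = IsExpectation-bind
        (𝔼-bernoullis-isExpectation (λ m → αs-prob m (supp Π m)))
        (λ ys → IsExpectation-map (purchases xs ys) (𝔼-addOns-isExpectation (addOnProb-prob Π) xs))

      𝔼-purchases-isExpectation : ∀ Π → IsExpectation (𝔼-purchases 𝓜 D Π)
      𝔼-purchases-isExpectation Π = IsExpectation-bind
        (𝔼-bernoullis-isExpectation (λ n → αc-prob n (core Π n)))
        (𝔼-purchases-givenCore-isExpectation Π)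

      module _ (𝓐 : Algorithm 𝓜) where

        -- The recursion of `regretFrom` for an arbitrary cost per policy, so that regret and counts
        -- of price uses are instances of one functional.
        cumulative : (FeasiblePolicy 𝓜 → Carrier) → History 𝓜 → ℕ → Carrier
        cumulative cost h zero    = 0#
        cumulative cost h (suc T) = 𝔼 (𝓐 h) λ Π →
          cost Π + 𝔼-purchases 𝓜 D Π (λ o → cumulative cost ((Π , o) ∷ h) T)

        regretFrom-cumulative : ∀ {R* cost} → (∀ Π → R* - revenue 𝓜 D Π ≈ cost Π) →
          ∀ h T → regretFrom 𝓜 D R* 𝓐 h T ≈ cumulative cost h T
        regretFrom-cumulative cost≈ h zero    = refl
        regretFrom-cumulative cost≈ h (suc T) = cong (𝔼-isExpectation (𝓐 h)) λ Π →
          +-cong (cost≈ Π) (cong (𝔼-purchases-isExpectation Π) λ o →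
            regretFrom-cumulative cost≈ ((Π , o) ∷ h) T)

        -- Linearity of expectation over the whole horizon. It turns a regret that is affine in
        -- indicators into expected counts.
        cumulative-affine : ∀ {n} z (w : Fin n → Carrier) (cost : Fin n → FeasiblePolicy 𝓜 → Carrier) h T →
          cumulative (λ Π → z + sum (λ i → w i * cost i Π)) h T ≈
          fromℕ T * z + sum (λ i → w i * cumulative (cost i) h T)
        cumulative-affine z w cost h zero = sym (begin-equality
          0# * z + sum (λ i → w i * 0#)  ≈⟨ +-congˡ (*-distribʳ-sum 0# w) ⟨
          0# * z + sum w * 0#            ≈⟨ solve 2 (λ z s → con (+ 0) :* z :+ s :* con (+ 0) := con (+ 0)) refl z (sum w) ⟩
          0#                             ∎)
        cumulative-affine z w cost h (suc T) = begin-equality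
          𝔼 (𝓐 h) (λ Π → z + sum (λ i → w i * cost i Π) +
            P Π (λ o → cumulative (λ Π → z + sum (λ i → w i * cost i Π)) ((Π , o) ∷ h) T))
            ≈⟨ cong eA (λ Π → +-congˡ {cost′ Π} (cong (eP Π) (λ o → cumulative-affine z w cost ((Π , o) ∷ h) T))) ⟩
          𝔼 (𝓐 h) (λ Π → z + sum (λ i → w i * cost i Π) +
            P Π (λ o → fromℕ T * z + sum (λ i → w i * C i Π o)))
            ≈⟨ cong eA (λ Π → +-congˡ {cost′ Π} (trans (add (eP Π) _ _)
                 (+-cong (const (eP Π) _) (linear (eP Π) w (λ i → C i Π))))) ⟩
          𝔼 (𝓐 h) (λ Π → z + sum (λ i → w i * cost i Π) +
            (fromℕ T * z + sum (λ i → w i * P Π (C i Π))))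
            ≈⟨ cong eA (λ Π → trans
                 (solve 4 (λ z t x y → z :+ x :+ (t :* z :+ y) := (con (+ 1) :+ t) :* z :+ (x :+ y))
                   refl z (fromℕ T) (sum (λ i → w i * cost i Π)) (sum (λ i → w i * P Π (C i Π))))
                 (+-congˡ (sym (sum-linear w (λ i → cost i Π) (λ i → P Π (C i Π)))))) ⟩
          𝔼 (𝓐 h) (λ Π → fromℕ (suc T) * z + sum (λ i → w i * (cost i Π + P Π (C i Π))))
            ≈⟨ trans (add eA _ (λ Π → sum (λ i → w i * (cost i Π + P Π (C i Π)))))
                 (+-cong (const eA _) (linear eA w (λ i Π → cost i Π + P Π (C i Π)))) ⟩
          fromℕ (suc T) * z + sum (λ i → w i * 𝔼 (𝓐 h) (λ Π → cost i Π + P Π (C i Π))) ∎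
          where
          eA = 𝔼-isExpectation (𝓐 h)
          eP = 𝔼-purchases-isExpectation
          P = 𝔼-purchases 𝓜 D
          cost′ : FeasiblePolicy 𝓜 → Carrier
          cost′ Π = z + sum (λ i → w i * cost i Π)
          C : ∀ i → (Π : FeasiblePolicy 𝓜) → Purchases 𝓜 → Carrier
          C i Π o = cumulative (cost i) ((Π , o) ∷ h) T

-- The potential of a weight and its growth in one period.

module Potential {c ℓ₁ ℓ₂} (F : EuclideanField c ℓ₁ ℓ₂) where
  open EuclideanField F hiding (zero)
  open FieldProperties F

  -- If y = 1 / (w + 1), this is (2w - 1)² / (w + 1).
  potential : Carrier → Carrier → Carrier
  potential w y = # 4 * w + # 9 * y - # 8

  module _ {w y : Carrier} (0≤w : 0# ≤ w) (y-inv : y * (w + 1#) ≈ 1#) where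

    resolvent-nonNeg : 0# ≤ y
    resolvent-nonNeg = inverse-nonNeg (+-nonNeg 0≤w 0≤1) (trans (*-comm _ _) y-inv)

    resolvent-≤1 : y ≤ 1#
    resolvent-≤1 = ≤-by-difference (*-nonNeg 0≤w resolvent-nonNeg)
      (trans (solve 2 (λ w y → y :+ w :* y := y :* (w :+ con (+ 1))) refl w y) y-inv)

    w*resolvent-≤1 : w * y ≤ 1#
    w*resolvent-≤1 = ≤-by-difference resolvent-nonNeg
      (trans (solve 2 (λ w y → w :* y :+ y := y :* (w :+ con (+ 1))) refl w y) y-inv)

    potential-nonNeg : 0# ≤ potential w y
    potential-nonNeg = ≤-respʳ eq (*-nonNeg resolvent-nonNeg (square-nonNeg (# 2 * w - 1#)))
      where
      eq : y * ((# 2 * w - 1#) * (# 2 * w - 1#)) ≈ potential w y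
      eq = begin-equality
        y * ((# 2 * w - 1#) * (# 2 * w - 1#))
          -- Division with remainder: `(2w - 1)² = (4w - 8)(w + 1) + 9`, the source of the constants
          -- 8 and 9.
          ≈⟨ solve 2 (λ w y →
               y :* ((con (+ 2) :* w :- con (+ 1)) :* (con (+ 2) :* w :- con (+ 1))) :=
               (con (+ 4) :* w :- con (+ 8)) :* (y :* (w :+ con (+ 1))) :+ con (+ 9) :* y) refl w y ⟩
        (# 4 * w - # 8) * (y * (w + 1#)) + # 9 * y
          ≈⟨ +-congʳ (*-congˡ y-inv) ⟩
        (# 4 * w - # 8) * 1# + # 9 * y
          ≈⟨ solve 2 (λ w y → (con (+ 4) :* w :- con (+ 8)) :* con (+ 1) :+ con (+ 9) :* y :=
               con (+ 4) :* w :+ con (+ 9) :* y :- con (+ 8)) refl w y ⟩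
        potential w y ∎

    4w≤8+potential : # 4 * w ≤ # 8 + potential w y
    4w≤8+potential = ≤-by-difference (*-nonNeg (#-nonNeg 9) resolvent-nonNeg)
      (solve 2 (λ w y → con (+ 4) :* w :+ con (+ 9) :* y :=
        con (+ 8) :+ (con (+ 4) :* w :+ con (+ 9) :* y :- con (+ 8))) refl w y)

  -- Second-order expansion of d ↦ 1 / (w (1 + d) + 1) at d = 0.
  resolvent-expansion : ∀ {w y d y′} → 0# ≤ w → y * (w + 1#) ≈ 1# →
                        0# ≤ w * (1# + d) → y′ * (w * (1# + d) + 1#) ≈ 1# →
                        y′ ≤ y - d * (w * y * y) + d * d
  resolvent-expansion {w} {y} {d} {y′} 0≤w y-inv 0≤w′ y′-inv = begin
    y′                                   ≈⟨ solve 1 (λ y′ → y′ := y′ :* (con (+ 1) :* con (+ 1))) refl y′ ⟩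
    y′ * (1# * 1#)                       ≈⟨ *-congˡ (*-cong y-inv y-inv) ⟨
    -- An exact Taylor identity with remainder `d² (w y)² y′`. The factors `Y` and `Y′`, both equal
    -- to 1, are kept so that it is a polynomial identity. In the remainder `w y` and `y′` are at
    -- most 1.
    y′ * (Y * Y)                         ≈⟨ solve 4 (λ w y d y′ →
      let Y = y :* (w :+ con (+ 1)); Y′ = y′ :* (w :* (con (+ 1) :+ d) :+ con (+ 1)) in
      y′ :* (Y :* Y) := y :* Y :* Y′ :- d :* (w :* y :* y) :* Y′ :+ d :* d :* (w :* y :* (w :* y) :* y′))
      refl w y d y′ ⟩
    y * Y * Y′ - d * (w * y * y) * Y′ + d * d * (w * y * (w * y) * y′)
      ≈⟨ +-congʳ (+-cong
           (trans (*-cong (trans (*-congˡ y-inv) (*-identityʳ _)) y′-inv) (*-identityʳ _))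
           (-‿cong (trans (*-congˡ y′-inv) (*-identityʳ _)))) ⟩
    y - d * (w * y * y) + d * d * (w * y * (w * y) * y′)
      ≤⟨ +-monoʳ-≤ _ (*-monoˡ-≤ (square-nonNeg d) wywyy′≤1) ⟩
    y - d * (w * y * y) + d * d * 1#     ≈⟨ +-congˡ (*-identityʳ _) ⟩
    y - d * (w * y * y) + d * d          ∎
    where
    Y Y′ : Carrier
    Y = y * (w + 1#)
    Y′ = y′ * (w * (1# + d) + 1#)
    0≤y′ : 0# ≤ y′
    0≤y′ = resolvent-nonNeg 0≤w′ y′-inv
    0≤wy : 0# ≤ w * y
    0≤wy = *-nonNeg 0≤w (resolvent-nonNeg 0≤w y-inv)
    wywyy′≤1 : w * y * (w * y) * y′ ≤ 1#
    wywyy′≤1 = begin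
      w * y * (w * y) * y′   ≤⟨ *-monoʳ-≤ 0≤y′ (*-monoˡ-≤ 0≤wy (w*resolvent-≤1 0≤w y-inv)) ⟩
      w * y * 1# * y′        ≤⟨ *-monoʳ-≤ 0≤y′ (*-monoʳ-≤ 0≤1 (w*resolvent-≤1 0≤w y-inv)) ⟩
      1# * 1# * y′           ≈⟨ solve 1 (λ y′ → con (+ 1) :* con (+ 1) :* y′ := y′) refl y′ ⟩
      y′                     ≤⟨ resolvent-≤1 0≤w′ y′-inv ⟩
      1#                     ∎

  -- `ρ` is the odds `a / (1 - a)`. Raising the sale probability from `a` to `a (1 + e)` lowers that
  -- of no sale to `(1 - a)(1 - ρ e)`, so `1 + e` and `1 - ρ e` are the two likelihood ratios. The
  -- bound `a ≤ 1# - a` says that `a` is at most one half.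
  module _ {a ρ : Carrier} (0≤a : 0# ≤ a) (a≤1-a : a ≤ 1# - a) (0≤ρ : 0# ≤ ρ) (ρ≤1 : ρ ≤ 1#)
           (ρ-odds : (1# - a) * ρ ≈ a) where

    -- The weight w is multiplied by 1 + e with probability a and by 1 - ρ e
    -- otherwise. This leaves its mean unchanged, so only the second-order term
    -- of the resolvent contributes.
    resolvent-drift : ∀ {w y y₁ y₀ e} → 0# ≤ w → 0# ≤ e → e ≤ 1# →
      y * (w + 1#) ≈ 1# →
      y₁ * (w * (1# + e) + 1#) ≈ 1# →
      y₀ * (w * (1# - ρ * e) + 1#) ≈ 1# →
      a * y₁ + (1# - a) * y₀ ≤ y + e * e
    resolvent-drift {w} {y} {y₁} {y₀} {e} 0≤w 0≤e e≤1 y-inv y₁-inv y₀-inv = begin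
      a * y₁ + (1# - a) * y₀
        ≤⟨ +-mono-≤
             (*-monoˡ-≤ 0≤a (resolvent-expansion 0≤w y-inv (*-nonNeg 0≤w (+-nonNeg 0≤1 0≤e)) y₁-inv))
             (*-monoˡ-≤ 0≤1-a (resolvent-expansion 0≤w y-inv (*-nonNeg 0≤w (x≤y⇒0≤y-x ρe≤1)) y₀-inv)) ⟩
      a * (y - e * X + e * e) + (1# - a) * (y - - (ρ * e) * X + - (ρ * e) * - (ρ * e))
        -- The coefficient of `e * X` vanishes by `ρ-odds`. That of `e * e` becomes `a + a * ρ`, at
        -- most 1 because `ρ ≤ 1#` and `a ≤ 1# - a`.
        ≈⟨ solve 5 (λ a ρ y e X →
             a :* (y :- e :* X :+ e :* e) :+
             (con (+ 1) :- a) :* (y :- (:- (ρ :* e)) :* X :+ (:- (ρ :* e)) :* (:- (ρ :* e))) :=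
             y :+ (e :* X) :* ((con (+ 1) :- a) :* ρ :- a) :+ e :* e :* (a :+ (con (+ 1) :- a) :* ρ :* ρ))
             refl a ρ y e X ⟩
      y + e * X * ((1# - a) * ρ - a) + e * e * (a + (1# - a) * ρ * ρ)
        ≈⟨ +-cong (+-congˡ (*-congˡ (+-congʳ ρ-odds))) (*-congˡ (+-congˡ (*-congʳ ρ-odds))) ⟩
      y + e * X * (a - a) + e * e * (a + a * ρ)
        ≈⟨ +-congʳ (solve 3 (λ a y Z → y :+ Z :* (a :- a) := y) refl a y (e * X)) ⟩
      y + e * e * (a + a * ρ)
        ≤⟨ +-monoʳ-≤ y (*-monoˡ-≤ (square-nonNeg e) (+-monoʳ-≤ a (*-monoˡ-≤ 0≤a ρ≤1))) ⟩
      y + e * e * (a + a * 1#)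
        ≤⟨ +-monoʳ-≤ y (*-monoˡ-≤ (square-nonNeg e)
             (≤-respˡ (+-congˡ (sym (*-identityʳ a))) (+-monoʳ-≤ a a≤1-a))) ⟩
      y + e * e * (a + (1# - a))
        ≈⟨ solve 3 (λ y e a → y :+ e :* e :* (a :+ (con (+ 1) :- a)) := y :+ e :* e) refl y e a ⟩
      y + e * e ∎
      where
      X : Carrier
      X = w * y * y
      0≤1-a : 0# ≤ 1# - a
      0≤1-a = ≤-trans 0≤a a≤1-a
      ρe≤1 : ρ * e ≤ 1#
      ρe≤1 = begin
        ρ * e    ≤⟨ *-monoʳ-≤ 0≤e ρ≤1 ⟩
        1# * e   ≤⟨ *-monoˡ-≤ 0≤1 e≤1 ⟩
        1# * 1#  ≈⟨ *-identityˡ 1# ⟩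
        1#       ∎

    -- The other part of the potential is affine in the weight, whose mean is preserved, so only
    -- `# 9` times the resolvent drifts.
    potential-drift : ∀ {w y y₁ y₀ e} → 0# ≤ w → 0# ≤ e → e ≤ 1# →
      y * (w + 1#) ≈ 1# →
      y₁ * (w * (1# + e) + 1#) ≈ 1# →
      y₀ * (w * (1# - ρ * e) + 1#) ≈ 1# →
      a * potential (w * (1# + e)) y₁ + (1# - a) * potential (w * (1# - ρ * e)) y₀ ≤
      potential w y + # 9 * (e * e)
    potential-drift {w} {y} {y₁} {y₀} {e} 0≤w 0≤e e≤1 y-inv y₁-inv y₀-inv = begin
      a * potential (w * (1# + e)) y₁ + (1# - a) * potential (w * (1# - ρ * e)) y₀
        ≈⟨ solve 6 (λ a ρ w e y₁ y₀ →
             a :* (con (+ 4) :* (w :* (con (+ 1) :+ e)) :+ con (+ 9) :* y₁ :- con (+ 8)) :+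
             (con (+ 1) :- a) :* (con (+ 4) :* (w :* (con (+ 1) :- ρ :* e)) :+ con (+ 9) :* y₀ :- con (+ 8)) :=
             con (+ 4) :* w :+ con (+ 4) :* (w :* e) :* (a :- (con (+ 1) :- a) :* ρ) :- con (+ 8) :+
             con (+ 9) :* (a :* y₁ :+ (con (+ 1) :- a) :* y₀)) refl a ρ w e y₁ y₀ ⟩
      # 4 * w + # 4 * (w * e) * (a - (1# - a) * ρ) - # 8 + # 9 * (a * y₁ + (1# - a) * y₀)
        ≈⟨ +-congʳ (+-congʳ (+-congˡ (*-congˡ (+-congˡ (-‿cong ρ-odds))))) ⟩
      # 4 * w + # 4 * (w * e) * (a - a) - # 8 + # 9 * (a * y₁ + (1# - a) * y₀)
        ≤⟨ +-monoʳ-≤ _ (*-monoˡ-≤ (#-nonNeg 9) (resolvent-drift 0≤w 0≤e e≤1 y-inv y₁-inv y₀-inv)) ⟩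
      # 4 * w + # 4 * (w * e) * (a - a) - # 8 + # 9 * (y + e * e)
        ≈⟨ solve 4 (λ a w e y →
             con (+ 4) :* w :+ con (+ 4) :* (w :* e) :* (a :- a) :- con (+ 8) :+ con (+ 9) :* (y :+ e :* e) :=
             con (+ 4) :* w :+ con (+ 9) :* y :- con (+ 8) :+ con (+ 9) :* (e :* e)) refl a w e y ⟩
      potential w y + # 9 * (e * e) ∎

-- Instances with hidden prices, and how often an algorithm can use them.

module HiddenPrices {c ℓ₁ ℓ₂} (F : EuclideanField c ℓ₁ ℓ₂) where
  open EuclideanField F hiding (zero)
  open FieldProperties F
  open Expectation F
  open Potential F
  open AddOnDiscount F

  hit : ∀ {n} → Fin n → Fin n → Carrier
  hit i k = if does (i Fin.≟ k) then 1# else 0#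

  hit-nonNeg : ∀ {n} (i k : Fin n) → 0# ≤ hit i k
  hit-nonNeg i k with i Fin.≟ k
  ... | yes _ = 0≤1
  ... | no  _ = ≤-refl

  hit-≤1 : ∀ {n} (i k : Fin n) → hit i k ≤ 1#
  hit-≤1 i k with i Fin.≟ k
  ... | yes _ = ≤-refl
  ... | no  _ = 0≤1

  hit-idem : ∀ {n} (i k : Fin n) → hit i k * hit i k ≈ hit i k
  hit-idem i k with i Fin.≟ k
  ... | yes _ = *-identityˡ 1#
  ... | no  _ = zeroˡ 0#

  hit-refl : ∀ {n} (i : Fin n) → hit i i ≡ 1#
  hit-refl i with i Fin.≟ i
  ... | yes _   = ≡.refl
  ... | no  i≢i = contradiction ≡.refl i≢i

  sum-hit : ∀ {n} (x : Fin n → Carrier) k → sum (λ i → x i * hit i k) ≈ x k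
  sum-hit x zero = trans (+-cong (*-identityʳ _) zeros) (+-identityʳ _)
    where
    zeros : sum (λ i → x (suc i) * 0#) ≈ 0#
    zeros = trans (sym (*-distribʳ-sum 0# (x ∘ suc))) (zeroʳ _)
  sum-hit x (suc k) = trans (+-cong (zeroʳ _) (sum-hit (x ∘ suc) k)) (+-identityˡ _)

  -- `a k` is the baseline sale probability at price `k`, common to all core products. Being at most
  -- one half, it remains a probability when multiplied by `1# + ε`.
  module RaisedPrices {N M : ℕ} (𝓜 : Market (suc N) M)
      (a : Fin (size (Market.Ωc 𝓜)) → Carrier) (0≤a : ∀ k → 0# ≤ a k) (a≤1-a : ∀ k → a k ≤ 1# - a k)
      (ε : Carrier) (0≤ε : 0# ≤ ε) (ε≤1 : ε ≤ 1#) where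

    private
      K = size (Market.Ωc 𝓜)

      e : Fin K → Fin K → Carrier
      e i k = ε * hit i k

      0≤e : ∀ i k → 0# ≤ e i k
      0≤e i k = *-nonNeg 0≤ε (hit-nonNeg i k)

      e≤1 : ∀ i k → e i k ≤ 1#
      e≤1 i k = begin
        ε * hit i k ≤⟨ *-monoˡ-≤ 0≤ε (hit-≤1 i k) ⟩
        ε * 1#      ≈⟨ *-identityʳ ε ⟩
        ε           ≤⟨ ε≤1 ⟩
        1#          ∎

    -- Abstract because comparing demands would otherwise unfold this proof.
    abstract
      raised-prob : ∀ i k → Probability (a k * (1# + e i k))
      raised-prob i k = *-nonNeg (0≤a k) (+-nonNeg 0≤1 (0≤e i k)) , (begin
        a k * (1# + e i k) ≤⟨ *-monoˡ-≤ (0≤a k) (+-monoʳ-≤ 1# (e≤1 i k)) ⟩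
        a k * (1# + 1#)    ≈⟨ solve 1 (λ a → a :* con (+ 2) := a :+ a) refl (a k) ⟩
        a k + a k          ≤⟨ +-monoʳ-≤ (a k) (a≤1-a k) ⟩
        a k + (1# - a k)   ≈⟨ solve 1 (λ a → a :+ (con (+ 1) :- a) := con (+ 1)) refl (a k) ⟩
        1#                 ∎)

    -- Entry n of v is the price whose demand for core product n is raised.
    demand : Vec (Fin K) (suc N) → Demand 𝓜
    demand v = record
      { αc      = λ n k → a k * (1# + e (lookup v n) k)
      ; αs      = λ _ _ → 0#
      ; β       = λ _ _ → 1#
      ; β′      = λ _ _ → 0#
      ; αc-prob = λ n k → raised-prob (lookup v n) k
      ; αs-prob = λ _ _ → ≤-refl , 0≤1
      ; β-prob  = λ _ _ → 0≤1 , ≤-refl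
      ; β′-prob = λ _ _ → ≤-refl , 0≤1
      }

    private
      1-a-unit : ∀ k → ∃ λ z → (1# - a k) * z ≈ 1#
      1-a-unit k = inverse (1# - a k) λ 1-a≈0 → 1≰0 (begin
        1#               ≈⟨ solve 1 (λ a → con (+ 1) := a :+ (con (+ 1) :- a)) refl (a k) ⟩
        a k + (1# - a k) ≤⟨ +-monoˡ-≤ _ (a≤1-a k) ⟩
        (1# - a k) + (1# - a k) ≈⟨ +-cong 1-a≈0 1-a≈0 ⟩
        0# + 0#          ≈⟨ +-identityˡ 0# ⟩
        0#               ∎)

      ρ : Fin K → Carrier
      ρ k = a k * proj₁ (1-a-unit k)

      ρ-odds : ∀ k → (1# - a k) * ρ k ≈ a k
      ρ-odds k = trans (solve 3 (λ p a z → p :* (a :* z) := a :* (p :* z)) refl (1# - a k) (a k) _)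
        (trans (*-congˡ (proj₂ (1-a-unit k))) (*-identityʳ _))

      0≤1-a : ∀ k → 0# ≤ 1# - a k
      0≤1-a k = ≤-trans (0≤a k) (a≤1-a k)

      0≤ρ : ∀ k → 0# ≤ ρ k
      0≤ρ k = *-nonNeg (0≤a k) (inverse-nonNeg (0≤1-a k) (proj₂ (1-a-unit k)))

      ρ≤1 : ∀ k → ρ k ≤ 1#
      ρ≤1 k = ≤-respʳ (proj₂ (1-a-unit k))
        (*-monoʳ-≤ (inverse-nonNeg (0≤1-a k) (proj₂ (1-a-unit k))) (a≤1-a k))

    module _ (𝓐 : Algorithm 𝓜) (n : Fin (suc N)) where
      open FeasiblePolicy using (core)

      hits : Vec (Fin K) (suc N) → History 𝓜 → ℕ → Carrier
      hits v = cumulative 𝓜 (demand v) 𝓐 λ Π → hit (lookup v n) (core Π n)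

      module _ (v : Vec (Fin K) (suc N)) where

        private
          -- The law of a period's purchases conditional on whether core product `n` sells. Entry
          -- `n` of `v` does not enter, so one functional serves all positions `i` of the hidden
          -- price.
          givenSale : FeasiblePolicy 𝓜 → Bool → (Purchases 𝓜 → Carrier) → Carrier
          givenSale Π b f =
            𝔼-bernoullis (λ m → Demand.αc (demand v) (punchIn n m) (core Π (punchIn n m))) λ bs →
            𝔼-purchases-givenCore 𝓜 (demand v) Π f (insertAt bs n b)

          givenSale-isExpectation : ∀ Π b → IsExpectation (givenSale Π b)
          givenSale-isExpectation Π b = IsExpectation-bind
            (𝔼-bernoullis-isExpectation (λ m → Demand.αc-prob (demand v) (punchIn n m) (core Π (punchIn n m))))
            (λ bs → 𝔼-purchases-givenCore-isExpectation 𝓜 (demand v) Π (insertAt bs n b))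

          -- Change of measure: the law for hidden price `i` is the baseline law with its two
          -- branches reweighted by the likelihood ratios.
          𝔼-purchases-split : ∀ Π i f → let k = core Π n in
            𝔼-purchases 𝓜 (demand (v [ n ]≔ i)) Π f ≈
            a k * ((1# + e i k) * givenSale Π true f) +
            (1# - a k) * ((1# - ρ k * e i k) * givenSale Π false f)
          𝔼-purchases-split Π i f = begin-equality
            𝔼-purchases 𝓜 (demand (v [ n ]≔ i)) Π f
              ≈⟨ 𝔼-bernoullis-condition n
                   (λ m → Demand.αc (demand (v [ n ]≔ i)) m (core Π m))
                   (λ m → Demand.αc (demand v) m (core Π m))
                   (λ m → reflexive (≡.cong (λ j → a (core Π (punchIn n m)) * (1# + e j (core Π (punchIn n m))))
                     (lookup∘update′ (punchInᵢ≢i n m) v i)))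
                   -- Moving the hidden price changes `αc` only, so the later stages under
                   -- `v [ n ]≔ i` and under `v` agree definitionally.
                   (𝔼-purchases-givenCore 𝓜 (demand v) Π f) ⟩
            q (lookup (v [ n ]≔ i) n) * Gt + (1# - q (lookup (v [ n ]≔ i) n)) * Gf
              ≡⟨ ≡.cong (λ j → q j * Gt + (1# - q j) * Gf) (lookup∘update n v i) ⟩
            q i * Gt + (1# - q i) * Gf
              ≈⟨ +-congˡ (*-congʳ (begin-equality
                   1# - a k * (1# + e i k)
                     ≈⟨ solve 2 (λ a e → con (+ 1) :- a :* (con (+ 1) :+ e) := con (+ 1) :- a :- a :* e)
                          refl (a k) (e i k) ⟩
                   1# - a k - a k * e i k
                     ≈⟨ +-congˡ (-‿cong (*-congʳ (ρ-odds k))) ⟨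
                   1# - a k - (1# - a k) * ρ k * e i k
                     ≈⟨ solve 3 (λ p ρ e → p :- p :* ρ :* e := p :* (con (+ 1) :- ρ :* e))
                          refl (1# - a k) (ρ k) (e i k) ⟩
                   (1# - a k) * (1# - ρ k * e i k) ∎)) ⟩
            q i * Gt + (1# - a k) * (1# - ρ k * e i k) * Gf
              ≈⟨ +-cong (*-assoc _ _ _) (*-assoc _ _ _) ⟩
            a k * ((1# + e i k) * Gt) + (1# - a k) * ((1# - ρ k * e i k) * Gf) ∎
            where
            k = core Π n
            Gt = givenSale Π true f
            Gf = givenSale Π false f
            q : Fin K → Carrier
            q i = a k * (1# + e i k)

        totalPotential : (w y : Fin K → Carrier) → Carrier
        totalPotential w y = sum λ i → potential (w i) (y i)

        -- Each remaining period contributes at most 8 plus the total potential of the moment. The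
        -- mean of that potential grows by at most `9 ε²` per period, hence never by more than
        -- `9 ε² T`.
        hitsBound : (w y : Fin K → Carrier) → ℕ → Carrier
        hitsBound w y T = fromℕ T * (# 8 + totalPotential w y + # 9 * (ε * ε) * fromℕ T)

        -- The weights w play the role of the likelihood ratios, on the current
        -- history, of the demands with n-th raised price i.
        weightedHits-≤ : ∀ T h (w y : Fin K → Carrier) →
          (∀ i → 0# ≤ w i) → (∀ i → y i * (w i + 1#) ≈ 1#) →
          # 4 * sum (λ i → w i * hits (v [ n ]≔ i) h T) ≤ hitsBound w y T
        weightedHits-≤ zero h w y 0≤w y-inv = ≤-reflexive (begin-equality
          # 4 * sum (λ i → w i * 0#) ≈⟨ *-congˡ (*-distribʳ-sum 0# w) ⟨
          # 4 * (sum w * 0#)         ≈⟨ solve 2 (λ s z → con (+ 4) :* (s :* con (+ 0)) := con (+ 0) :* z) refl (sum w) _ ⟩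
          hitsBound w y zero         ∎)
        weightedHits-≤ (suc T) h w y 0≤w y-inv =
          -- The algorithm sees only `h`, so the next policy has the same law for every `i`. The
          -- weighted sum moves inside `𝔼 (𝓐 h)` and is bounded policy by policy.
          ≤-respˡ (trans (scale eA (# 4) (λ Π → sum λ i → w i * (hit (lookup (v [ n ]≔ i) n) (core Π n) + P Π i)))
                    (*-congˡ (linear eA w (λ i Π → hit (lookup (v [ n ]≔ i) n) (core Π n) + P Π i))))
            (upperBound eA onePolicy)
          where
          eA = 𝔼-isExpectation (𝓐 h)
          t = fromℕ T
          S = totalPotential w y
          C : (Π : FeasiblePolicy 𝓜) → Fin K → Purchases 𝓜 → Carrier
          C Π i o = hits (v [ n ]≔ i) ((Π , o) ∷ h) T
          P : FeasiblePolicy 𝓜 → Fin K → Carrier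
          P Π i = 𝔼-purchases 𝓜 (demand (v [ n ]≔ i)) Π (C Π i)
          module _ (Π : FeasiblePolicy 𝓜) where
            k = core Π n
            -- The weights after a sale and after no sale of core product `n`, with their
            -- resolvents. As `e i k` vanishes for `i ≠ k`, only the weight of the price `k` in use
            -- moves.
            w₁ w₀ y₁ y₀ : Fin K → Carrier
            w₁ i = w i * (1# + e i k)
            w₀ i = w i * (1# - ρ k * e i k)
            0≤w₁ : ∀ i → 0# ≤ w₁ i
            0≤w₁ i = *-nonNeg (0≤w i) (+-nonNeg 0≤1 (0≤e i k))
            0≤w₀ : ∀ i → 0# ≤ w₀ i
            0≤w₀ i = *-nonNeg (0≤w i) (x≤y⇒0≤y-x (begin
              ρ k * e i k ≤⟨ *-monoʳ-≤ (0≤e i k) (ρ≤1 k) ⟩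
              1# * e i k  ≈⟨ *-identityˡ _ ⟩
              e i k       ≤⟨ e≤1 i k ⟩
              1#          ∎))
            resolvent : ∀ {x} → 0# ≤ x → ∃ λ z → (x + 1#) * z ≈ 1#
            resolvent {x} 0≤x = inverse (x + 1#) (≥1⇒≉0 (≤-by-difference 0≤x (+-comm 1# x)))
            y₁ i = proj₁ (resolvent (0≤w₁ i))
            y₀ i = proj₁ (resolvent (0≤w₀ i))
            y₁-inv : ∀ i → y₁ i * (w₁ i + 1#) ≈ 1#
            y₁-inv i = trans (*-comm _ _) (proj₂ (resolvent (0≤w₁ i)))
            y₀-inv : ∀ i → y₀ i * (w₀ i + 1#) ≈ 1#
            y₀-inv i = trans (*-comm _ _) (proj₂ (resolvent (0≤w₀ i)))

            -- Only the price in use contributes a second-order term, so the growth is `9 ε²` in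
            -- total and not once per price.
            totalPotential-drift :
              a k * totalPotential w₁ y₁ + (1# - a k) * totalPotential w₀ y₀ ≤ S + # 9 * (ε * ε)
            totalPotential-drift = begin
              a k * totalPotential w₁ y₁ + (1# - a k) * totalPotential w₀ y₀
                ≈⟨ sum-combination (a k) (1# - a k) (λ i → potential (w₁ i) (y₁ i)) (λ i → potential (w₀ i) (y₀ i)) ⟩
              sum (λ i → a k * potential (w₁ i) (y₁ i) + (1# - a k) * potential (w₀ i) (y₀ i))
                ≤⟨ sum-mono-≤ (λ i → ≤-respʳ (+-congˡ (square-e i))
                     (potential-drift (0≤a k) (a≤1-a k) (0≤ρ k) (ρ≤1 k) (ρ-odds k)
                       (0≤w i) (0≤e i k) (e≤1 i k) (y-inv i) (y₁-inv i) (y₀-inv i))) ⟩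
              sum (λ i → potential (w i) (y i) + # 9 * (ε * ε) * hit i k)
                ≈⟨ ∑-distrib-+ (λ i → potential (w i) (y i)) _ ⟩
              S + sum (λ i → # 9 * (ε * ε) * hit i k)
                ≈⟨ +-congˡ (sum-hit (λ _ → # 9 * (ε * ε)) k) ⟩
              S + # 9 * (ε * ε) ∎
              where
              square-e : ∀ i → # 9 * (e i k * e i k) ≈ # 9 * (ε * ε) * hit i k
              square-e i = trans
                (solve 2 (λ ε d → con (+ 9) :* (ε :* d :* (ε :* d)) := con (+ 9) :* (ε :* ε) :* (d :* d))
                  refl ε (hit i k))
                (*-congˡ (hit-idem i k))

            -- The induction hypothesis holds for every outcome `o` with the same updated weights,
            -- and is averaged over the conditional law.
            given-≤ : ∀ b {w′ y′} → (∀ i → 0# ≤ w′ i) → (∀ i → y′ i * (w′ i + 1#) ≈ 1#) →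
              # 4 * sum (λ i → w′ i * givenSale Π b (C Π i)) ≤ hitsBound w′ y′ T
            given-≤ b {w′} {y′} 0≤w′ y′-inv = ≤-respˡ
              (trans (scale eG (# 4) (λ o → sum λ i → w′ i * C Π i o)) (*-congˡ (linear eG w′ (C Π))))
              (upperBound eG (λ o → weightedHits-≤ T ((Π , o) ∷ h) w′ y′ 0≤w′ y′-inv))
              where eG = givenSale-isExpectation Π b

            -- The present period counts only towards hidden price `k`. Its weight is controlled by
            -- its own potential, and the other potentials are nonnegative.
            current-≤ : # 4 * w k ≤ # 8 + S
            current-≤ = ≤-trans (4w≤8+potential (0≤w k) (y-inv k))
              (+-monoʳ-≤ (# 8) (term≤sum (λ i → potential-nonNeg (0≤w i) (y-inv i)) k))

            Gt Gf : Fin K → Carrier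
            Gt i = givenSale Π true (C Π i)
            Gf i = givenSale Π false (C Π i)

            split : sum (λ i → w i * (hit (lookup (v [ n ]≔ i) n) k + P Π i)) ≈
                    w k + (a k * sum (λ i → w₁ i * Gt i) + (1# - a k) * sum (λ i → w₀ i * Gf i))
            split = begin-equality
              sum (λ i → w i * (hit (lookup (v [ n ]≔ i) n) k + P Π i))
                ≈⟨ sum-cong-≋ (λ i → trans
                     (*-congˡ (+-cong (reflexive (≡.cong (λ j → hit j k) (lookup∘update n v i)))
                                      (𝔼-purchases-split Π i (C Π i))))
                     (solve 8 (λ w d a p f₁ f₀ x y →
                       w :* (d :+ (a :* (f₁ :* x) :+ p :* (f₀ :* y))) :=
                       w :* d :+ (a :* (w :* f₁ :* x) :+ p :* (w :* f₀ :* y))) refl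
                       (w i) (hit i k) (a k) (1# - a k) (1# + e i k) (1# - ρ k * e i k) (Gt i) (Gf i))) ⟩
              sum (λ i → w i * hit i k + (a k * (w₁ i * Gt i) + (1# - a k) * (w₀ i * Gf i)))
                ≈⟨ trans (∑-distrib-+ (λ i → w i * hit i k) _) (+-cong (sum-hit w k)
                     (sym (sum-combination (a k) (1# - a k) (λ i → w₁ i * Gt i) (λ i → w₀ i * Gf i)))) ⟩
              w k + (a k * sum (λ i → w₁ i * Gt i) + (1# - a k) * sum (λ i → w₀ i * Gf i)) ∎

            onePolicy : # 4 * sum (λ i → w i * (hit (lookup (v [ n ]≔ i) n) k + P Π i)) ≤ hitsBound w y (suc T)
            onePolicy = begin
              # 4 * sum (λ i → w i * (hit (lookup (v [ n ]≔ i) n) k + P Π i))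
                ≈⟨ *-congˡ split ⟩
              # 4 * (w k + (a k * sum (λ i → w₁ i * Gt i) + (1# - a k) * sum (λ i → w₀ i * Gf i)))
                ≈⟨ solve 5 (λ w a p x y → con (+ 4) :* (w :+ (a :* x :+ p :* y)) :=
                     con (+ 4) :* w :+ (a :* (con (+ 4) :* x) :+ p :* (con (+ 4) :* y))) refl
                     (w k) (a k) (1# - a k) (sum (λ i → w₁ i * Gt i)) (sum (λ i → w₀ i * Gf i)) ⟩
              # 4 * w k + (a k * (# 4 * sum (λ i → w₁ i * Gt i)) + (1# - a k) * (# 4 * sum (λ i → w₀ i * Gf i)))
                ≤⟨ +-mono-≤ current-≤ (+-mono-≤
                     (*-monoˡ-≤ (0≤a k) (given-≤ true 0≤w₁ y₁-inv))
                     (*-monoˡ-≤ (0≤1-a k) (given-≤ false 0≤w₀ y₀-inv))) ⟩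
              # 8 + S + (a k * hitsBound w₁ y₁ T + (1# - a k) * hitsBound w₀ y₀ T)
                ≈⟨ solve 6 (λ a s x y t q →
                     con (+ 8) :+ s :+ (a :* (t :* (con (+ 8) :+ x :+ q :* t)) :+
                       (con (+ 1) :- a) :* (t :* (con (+ 8) :+ y :+ q :* t))) :=
                     con (+ 8) :+ s :+ t :* (con (+ 8) :+ (a :* x :+ (con (+ 1) :- a) :* y) :+ q :* t)) refl
                     (a k) S (totalPotential w₁ y₁) (totalPotential w₀ y₀) t (# 9 * (ε * ε)) ⟩
              # 8 + S + t * (# 8 + (a k * totalPotential w₁ y₁ + (1# - a k) * totalPotential w₀ y₀) + Q * t)
                ≤⟨ +-monoʳ-≤ _ (*-monoˡ-≤ (fromℕ-nonNeg T)
                     (+-monoˡ-≤ _ (+-monoʳ-≤ (# 8) totalPotential-drift))) ⟩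
              # 8 + S + t * (# 8 + (S + Q) + Q * t)
                -- The slack is `9 ε² (1 + T)`: the bound charges the full-horizon growth to every
                -- period.
                ≤⟨ ≤-by-difference (*-nonNeg (*-nonNeg (#-nonNeg 9) (square-nonNeg ε)) (fromℕ-nonNeg (suc T)))
                     (solve 3 (λ s q t →
                       con (+ 8) :+ s :+ t :* (con (+ 8) :+ (s :+ q) :+ q :* t) :+ q :* (con (+ 1) :+ t) :=
                       (con (+ 1) :+ t) :* (con (+ 8) :+ s :+ q :* (con (+ 1) :+ t))) refl S Q t) ⟩
              hitsBound w y (suc T) ∎
              where Q = # 9 * (ε * ε)

        -- All weights start at 2, where the potential is 9 / 3 = 3 and the factor 4 becomes 8. For
        -- two prices, a start at 1 would give nothing better than the trivial bound of `T` hits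
        -- each.
        totalHits-≤ : ∀ T h → # 8 * sum (λ i → hits (v [ n ]≔ i) h T) ≤
          fromℕ T * (# 8 + # 3 * fromℕ K + # 9 * (ε * ε) * fromℕ T)
        totalHits-≤ T h = begin
          # 8 * sum (λ i → hits (v [ n ]≔ i) h T)
            ≈⟨ solve 1 (λ x → con (+ 8) :* x := con (+ 4) :* (con (+ 2) :* x)) refl _ ⟩
          # 4 * (# 2 * sum (λ i → hits (v [ n ]≔ i) h T))
            ≈⟨ *-congˡ (*-distribˡ-sum (# 2) (λ i → hits (v [ n ]≔ i) h T)) ⟩
          # 4 * sum (λ i → # 2 * hits (v [ n ]≔ i) h T)
            ≤⟨ weightedHits-≤ T h (λ _ → # 2) (λ _ → ⅓) (λ _ → #-nonNeg 2) (λ _ → trans (*-comm ⅓ (# 3)) 3*⅓) ⟩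
          fromℕ T * (# 8 + sum {K} (λ _ → potential (# 2) ⅓) + # 9 * (ε * ε) * fromℕ T)
            ≈⟨ *-congˡ (+-congʳ (+-congˡ (trans (sum-const K _) (trans (*-comm _ _) (*-congʳ initial-potential))))) ⟩
          fromℕ T * (# 8 + # 3 * fromℕ K + # 9 * (ε * ε) * fromℕ T) ∎
          where
          ⅓-inverse : ∃ λ y → # 3 * y ≈ 1#
          ⅓-inverse = inverse (# 3) (≥1⇒≉0 (≤-by-difference (#-nonNeg 2) (+-comm 1# (# 2))))
          ⅓ : Carrier
          ⅓ = proj₁ ⅓-inverse
          3*⅓ : # 3 * ⅓ ≈ 1#
          3*⅓ = proj₂ ⅓-inverse
          initial-potential : potential (# 2) ⅓ ≈ # 3
          initial-potential = begin-equality
            potential (# 2) ⅓   ≈⟨ solve 1 (λ y → con (+ 4) :* con (+ 2) :+ con (+ 9) :* y :- con (+ 8) :=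
                                     con (+ 3) :* (con (+ 3) :* y)) refl ⅓ ⟩
            # 3 * (# 3 * ⅓)     ≈⟨ *-congˡ 3*⅓ ⟩
            # 3 * 1#            ≈⟨ *-identityʳ _ ⟩
            # 3                 ∎

        -- The bound on `ε` turns `totalHits-≤` into `32 X ≤ t (32 + 15 k)` for the total `X` of the
        -- hits. What is left of `32 k t` is `t (17 k - 32)`, and `17 k - 32 ≥ k` exactly when
        -- `k ≥ 2`, so a second price is needed here.
        totalMisses-≥ : ∀ T h → let k = fromℕ K; t = fromℕ T in
          # 36 * (ε * ε * t) ≤ # 3 * k → # 2 ≤ k →
          k * t ≤ sum (λ i → # 32 * (t - hits (v [ n ]≔ i) h T))
        totalMisses-≥ T h 36ε²T≤3K 2≤K = begin
          k * t
            ≤⟨ ≤-by-difference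
                 (*-nonNeg (*-nonNeg (#-nonNeg 16) (fromℕ-nonNeg T)) (x≤y⇒0≤y-x 2≤K))
                 (solve 2 (λ k t →
                   k :* t :+ con (+ 16) :* t :* (k :- con (+ 2)) :=
                   con (+ 32) :* (k :* t) :- t :* (con (+ 32) :+ con (+ 15) :* k)) refl k t) ⟩
          # 32 * (k * t) - t * (# 32 + # 15 * k)
            ≤⟨ +-monoʳ-≤ _ (neg-antimono-≤ 32X≤) ⟩
          # 32 * (k * t) - # 32 * X
            ≈⟨ solve 3 (λ k t x → con (+ 32) :* (k :* t) :- con (+ 32) :* x :=
                 k :* (con (+ 32) :* t) :+ :- con (+ 32) :* x) refl k t X ⟩
          k * (# 32 * t) + - # 32 * X
            ≈⟨ +-cong (sym (sum-const K (# 32 * t))) (*-distribˡ-sum (- # 32) X-term) ⟩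
          sum {K} (λ _ → # 32 * t) + sum (λ i → - # 32 * X-term i)
            ≈⟨ ∑-distrib-+ {K} (λ _ → # 32 * t) (λ i → - # 32 * X-term i) ⟨
          sum (λ i → # 32 * t + - # 32 * X-term i)
            ≈⟨ sum-cong-≋ (λ i → solve 2 (λ t x →
                 con (+ 32) :* t :+ :- con (+ 32) :* x := con (+ 32) :* (t :- x)) refl t (X-term i)) ⟩
          sum (λ i → # 32 * (t - X-term i)) ∎
          where
          k t X : Carrier
          k = fromℕ K
          t = fromℕ T
          X-term : Fin K → Carrier
          X-term i = hits (v [ n ]≔ i) h T
          X = sum X-term
          32X≤ : # 32 * X ≤ t * (# 32 + # 15 * k)
          32X≤ = begin
            # 32 * X
              ≈⟨ solve 1 (λ x → con (+ 32) :* x := con (+ 4) :* (con (+ 8) :* x)) refl X ⟩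
            # 4 * (# 8 * X)
              ≤⟨ *-monoˡ-≤ (#-nonNeg 4) (totalHits-≤ T h) ⟩
            # 4 * (t * (# 8 + # 3 * k + # 9 * (ε * ε) * t))
              ≈⟨ solve 3 (λ t k e →
                   con (+ 4) :* (t :* (con (+ 8) :+ con (+ 3) :* k :+ con (+ 9) :* (e :* e) :* t)) :=
                   t :* (con (+ 32) :+ con (+ 12) :* k :+ con (+ 36) :* (e :* e :* t))) refl t k ε ⟩
            t * (# 32 + # 12 * k + # 36 * (ε * ε * t))
              ≤⟨ *-monoˡ-≤ (fromℕ-nonNeg T) (+-monoʳ-≤ _ 36ε²T≤3K) ⟩
            t * (# 32 + # 12 * k + # 3 * k)
              ≈⟨ solve 2 (λ t k → t :* (con (+ 32) :+ con (+ 12) :* k :+ con (+ 3) :* k) :=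
                   t :* (con (+ 32) :+ con (+ 15) :* k)) refl t k ⟩
            t * (# 32 + # 15 * k) ∎

-- The probability of a nonzero primary demand.

module NonzeroPrimary {c ℓ₁ ℓ₂} (F : EuclideanField c ℓ₁ ℓ₂) where
  open EuclideanField F hiding (zero)
  open FieldProperties F
  open Expectation F
  open AddOnDiscount F

  module _ {M} {r : Fin M → Carrier} (r-prob : ∀ m → Probability (r m)) where

    ℙ-any : ∀ {n} → (Fin n → Carrier) → Carrier
    ℙ-any q = 𝔼-bernoullis q λ xs → 𝔼-bernoullis r λ ys →
      if foldr′ _∨_ false (xs Vec.++ ys) then 1# else 0#

    -- A sale of the first core product makes the event certain. Otherwise it is the same event for
    -- the remaining products.
    ℙ-any-suc : ∀ {n} {q : Fin (suc n) → Carrier} → (∀ i → Probability (q i)) →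
                ℙ-any q ≈ q zero + (1# - q zero) * ℙ-any (q ∘ suc)
    ℙ-any-suc {q = q} q-prob = +-congʳ (trans (*-congˡ
      (trans (cong (𝔼-bernoullis-isExpectation (q-prob ∘ suc))
               (λ _ → const (𝔼-bernoullis-isExpectation r-prob) 1#))
             (const (𝔼-bernoullis-isExpectation (q-prob ∘ suc)) 1#)))
      (*-identityʳ _))

    ℙ-any-prob : ∀ {n} {q : Fin n → Carrier} → (∀ i → Probability (q i)) → Probability (ℙ-any q)
    ℙ-any-prob q-prob =
      lowerBound eq (λ xs → lowerBound er (λ ys → proj₁ (indicator (foldr′ _∨_ false (xs Vec.++ ys))))) ,
      upperBound eq (λ xs → upperBound er (λ ys → proj₂ (indicator (foldr′ _∨_ false (xs Vec.++ ys)))))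
      where
      eq = 𝔼-bernoullis-isExpectation q-prob
      er = 𝔼-bernoullis-isExpectation r-prob
      indicator : ∀ b → Probability (if b then 1# else 0#)
      indicator true  = 0≤1 , ≤-refl
      indicator false = ≤-refl , 0≤1

    -- By induction, as `q + (1 - q) y` increases in both arguments on probabilities. Hence a policy
    -- that prices each core product where it sells least attains the minimum.
    ℙ-any-mono : ∀ {n} {p q : Fin n → Carrier} → (∀ i → Probability (p i)) → (∀ i → Probability (q i)) →
                 (∀ i → p i ≤ q i) → ℙ-any p ≤ ℙ-any q
    ℙ-any-mono {zero}  p-prob q-prob p≤q = ≤-refl
    ℙ-any-mono {suc n} {p} {q} p-prob q-prob p≤q = begin
      ℙ-any p                                     ≈⟨ ℙ-any-suc p-prob ⟩
      p zero + (1# - p zero) * ℙ-any (p ∘ suc)    ≤⟨ ≤-by-difference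
        (+-nonNeg
          (*-nonNeg (x≤y⇒0≤y-x (p≤q zero)) (x≤y⇒0≤y-x (proj₂ (ℙ-any-prob (p-prob ∘ suc)))))
          (*-nonNeg (x≤y⇒0≤y-x (proj₂ (q-prob zero)))
                    (x≤y⇒0≤y-x (ℙ-any-mono (p-prob ∘ suc) (q-prob ∘ suc) (p≤q ∘ suc)))))
        (solve 4 (λ p q x y →
          p :+ (con (+ 1) :- p) :* x :+ ((q :- p) :* (con (+ 1) :- x) :+ (con (+ 1) :- q) :* (y :- x)) :=
          q :+ (con (+ 1) :- q) :* y) refl (p zero) (q zero) (ℙ-any (p ∘ suc)) (ℙ-any (q ∘ suc))) ⟩
      q zero + (1# - q zero) * ℙ-any (q ∘ suc)    ≈⟨ ℙ-any-suc q-prob ⟨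
      ℙ-any q                                     ∎

    head≤ℙ-any : ∀ {n} {q : Fin (suc n) → Carrier} → (∀ i → Probability (q i)) → q zero ≤ ℙ-any q
    head≤ℙ-any {q = q} q-prob = ≤-by-difference
      (*-nonNeg (x≤y⇒0≤y-x (proj₂ (q-prob zero))) (proj₁ (ℙ-any-prob (q-prob ∘ suc))))
      (sym (ℙ-any-suc q-prob))

-- Choosing all hidden prices simultaneously.

module Averaging {c ℓ₁ ℓ₂} (F : EuclideanField c ℓ₁ ℓ₂) where
  open EuclideanField F hiding (zero)
  open FieldProperties F

  -- The hypothesis for `n` averages over entry `n` with the others frozen, yet one vector must
  -- serve all `n`. The tail is chosen first, for the functions summed over the head, and
  -- `sum-average` then picks the head.
  coordinatewise-average : ∀ {k} .{{_ : ℕ.NonZero k}} N (f : Fin N → Vec (Fin k) N → Carrier) x →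
    (∀ n v → fromℕ k * x ≤ sum (λ i → f n (v [ n ]≔ i))) →
    ∃[ v ] fromℕ N * x ≤ sum (λ n → f n v)
  coordinatewise-average zero f x f-avg = [] , ≤-reflexive (zeroˡ x)
  coordinatewise-average {suc k} (suc N) f x f-avg =
    let v , rest-bound = coordinatewise-average N (λ n v → sum λ i → f (suc n) (i ∷ v)) (fromℕ (suc k) * x) rest-avg
        i , bound = sum-average (λ i → sum λ n → f n (i ∷ v)) (fromℕ (suc N) * x) (total-bound v rest-bound)
    in i ∷ v , bound
    where
    rest-avg : ∀ n v → fromℕ (suc k) * (fromℕ (suc k) * x) ≤
               sum (λ j → sum λ i → f (suc n) (i ∷ (v [ n ]≔ j)))
    rest-avg n v = begin
      fromℕ (suc k) * (fromℕ (suc k) * x)                 ≈⟨ sum-const (suc k) _ ⟨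
      sum {suc k} (λ _ → fromℕ (suc k) * x)               ≤⟨ sum-mono-≤ (λ i → f-avg (suc n) (i ∷ v)) ⟩
      sum (λ i → sum λ j → f (suc n) (i ∷ (v [ n ]≔ j)))  ≈⟨ ∑-comm (λ i j → f (suc n) (i ∷ (v [ n ]≔ j))) ⟩
      sum (λ j → sum λ i → f (suc n) (i ∷ (v [ n ]≔ j)))  ∎
    total-bound : ∀ v → fromℕ N * (fromℕ (suc k) * x) ≤ sum (λ n → sum λ i → f (suc n) (i ∷ v)) →
                  fromℕ (suc k) * (fromℕ (suc N) * x) ≤ sum (λ i → sum λ n → f n (i ∷ v))
    total-bound v rest-bound = begin
      fromℕ (suc k) * (fromℕ (suc N) * x)
        ≈⟨ solve 3 (λ k n x → k :* ((con (+ 1) :+ n) :* x) := k :* x :+ n :* (k :* x))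
             refl (fromℕ (suc k)) (fromℕ N) x ⟩
      fromℕ (suc k) * x + fromℕ N * (fromℕ (suc k) * x)
        -- The head `zero` is a placeholder that the update at position `zero` overwrites.
        ≤⟨ +-mono-≤ (f-avg zero (zero ∷ v)) rest-bound ⟩
      sum (λ i → f zero (i ∷ v)) + sum (λ n → sum λ i → f (suc n) (i ∷ v))
        ≈⟨ ∑-comm (λ n i → f n (i ∷ v)) ⟩
      sum (λ i → sum λ n → f n (i ∷ v)) ∎

-- The hard market, its demands and the constants.

module HardInstance {c ℓ₁ ℓ₂} (F : EuclideanField c ℓ₁ ℓ₂) where
  open EuclideanField F hiding (zero)
  open FieldProperties F
  open Expectation F
  open NonzeroPrimary F
  open Averaging F
  open Potential F
  open HiddenPrices F
  open AddOnDiscount F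

  private
    ¼-inverse : ∃ λ q → # 4 * q ≈ 1#
    ¼-inverse = inverse (# 4) (≥1⇒≉0 (≤-by-difference (#-nonNeg 3) (+-comm 1# (# 3))))

  ¼ : Carrier
  ¼ = proj₁ ¼-inverse

  4*¼ : # 4 * ¼ ≈ 1#
  4*¼ = proj₂ ¼-inverse

  0≤¼ : 0# ≤ ¼
  0≤¼ = inverse-nonNeg (#-nonNeg 4) 4*¼

  ¼≤1 : ¼ ≤ 1#
  ¼≤1 = ≤-by-difference (*-nonNeg (#-nonNeg 3) 0≤¼)
    (trans (solve 1 (λ q → q :+ con (+ 3) :* q := con (+ 4) :* q) refl ¼) 4*¼)

  -- Equals 1/256: the share 1/32 of missed periods, times 1/2 from the baseline profit
  -- `# 2 * ¼ * s`, times 1/4 from `ε`.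
  κ : Carrier
  κ = ¼ * ¼ * (¼ * ¼)

  0<κ : 0# < κ
  0<κ = *-nonNeg (*-nonNeg 0≤¼ 0≤¼) (*-nonNeg 0≤¼ 0≤¼) , λ 0≈κ → 1≉0 (begin-equality
    1#                                  ≈⟨ solve 0 (con (+ 1) := con (+ 1) :* con (+ 1) :* (con (+ 1) :* con (+ 1))) refl ⟩
    1# * 1# * (1# * 1#)                 ≈⟨ *-cong (*-cong 4*¼ 4*¼) (*-cong 4*¼ 4*¼) ⟨
    # 4 * ¼ * (# 4 * ¼) * (# 4 * ¼ * (# 4 * ¼))
      ≈⟨ solve 2 (λ f q → f :* q :* (f :* q) :* (f :* q :* (f :* q)) :=
           f :* f :* (f :* f) :* (q :* q :* (q :* q))) refl (# 4) ¼ ⟩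
    # 4 * # 4 * (# 4 * # 4) * κ         ≈⟨ *-congˡ 0≈κ ⟨
    # 4 * # 4 * (# 4 * # 4) * 0#        ≈⟨ zeroʳ _ ⟩
    0#                                  ∎)

  κ≤¼ : κ ≤ ¼
  κ≤¼ = begin
    ¼ * ¼ * (¼ * ¼)   ≤⟨ *-monoˡ-≤ (*-nonNeg 0≤¼ 0≤¼) (*-monoˡ-≤ 0≤¼ ¼≤1) ⟩
    ¼ * ¼ * (¼ * 1#)  ≤⟨ *-monoˡ-≤ (*-nonNeg 0≤¼ 0≤¼) (*-monoʳ-≤ 0≤1 ¼≤1) ⟩
    ¼ * ¼ * (1# * 1#) ≤⟨ *-monoʳ-≤ (*-nonNeg 0≤1 0≤1) (*-monoˡ-≤ 0≤¼ ¼≤1) ⟩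
    ¼ * 1# * (1# * 1#) ≈⟨ solve 1 (λ q → q :* con (+ 1) :* (con (+ 1) :* con (+ 1)) := q) refl ¼ ⟩
    ¼                 ∎

  fromℕ-≉ : ∀ {m n} → m ℕ.< n → ¬ (fromℕ m ≈ fromℕ n)
  fromℕ-≉ {m} {n} m<n eq = 1≰0 (begin
    1#                     ≈⟨ solve 1 (λ m → con (+ 1) := con (+ 1) :+ m :- m) refl (fromℕ m) ⟩
    1# + fromℕ m - fromℕ m ≤⟨ +-monoˡ-≤ _ (fromℕ-mono-≤ m<n) ⟩
    fromℕ n - fromℕ m      ≈⟨ +-congʳ eq ⟨
    fromℕ m - fromℕ m      ≈⟨ -‿inverseʳ _ ⟩
    0#                     ∎)

  fromℕ-injective : ∀ {m n} → fromℕ m ≈ fromℕ n → m ≡ n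
  fromℕ-injective {m} {n} eq with ℕ.<-cmp m n
  ... | tri< m<n _ _ = contradiction eq (fromℕ-≉ m<n)
  ... | tri≈ _ m≡n _ = m≡n
  ... | tri> _ _ n<m = contradiction (sym eq) (fromℕ-≉ n<m)

  unselected : ∀ {n} (p : Subset n) → ∣ p ∣ ℕ.≤ 0 → ∀ m → lookup p m ≡ false
  unselected (true  ∷ p) ()
  unselected (false ∷ p) none zero    = ≡.refl
  unselected (false ∷ p) none (suc m) = unselected p none m

  module Construction (N M U : ℕ) (1<U : 2 ℕ.≤ U) (p̂ : Carrier) (0<p̂ : 0# < p̂) where

    private instance
      U-nonZero : ℕ.NonZero U
      U-nonZero = ℕ.>-nonZero (ℕ.≤-trans (ℕ.s≤s ℕ.z≤n) 1<U)

    2≤U : # 2 ≤ fromℕ U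
    2≤U = ≤-respˡ (fromℕ≈# 2) (fromℕ-mono-≤ 1<U)

    1≤U : 1# ≤ fromℕ U
    1≤U = ≤-trans (≤-by-difference 0≤1 refl) 2≤U

    0≤p̂ : 0# ≤ p̂
    0≤p̂ = proj₁ 0<p̂

    p̂≉0 : ¬ (p̂ ≈ 0#)
    p̂≉0 = proj₂ 0<p̂ ∘ sym

    private
      U⁻¹-inverse : ∃ λ z → fromℕ U * z ≈ 1#
      U⁻¹-inverse = inverse (fromℕ U) (≥1⇒≉0 1≤U)

      U⁻¹ : Carrier
      U⁻¹ = proj₁ U⁻¹-inverse

      0≤U⁻¹ : 0# ≤ U⁻¹
      0≤U⁻¹ = inverse-nonNeg (fromℕ-nonNeg U) (proj₂ U⁻¹-inverse)

      step : Carrier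
      step = p̂ * U⁻¹

      step-unit : ∃ λ z → step * z ≈ 1#
      step-unit = let p̂⁻¹ , p̂-inv = inverse p̂ p̂≉0 in p̂⁻¹ * fromℕ U , (begin-equality
        p̂ * U⁻¹ * (p̂⁻¹ * fromℕ U)
          ≈⟨ solve 4 (λ p z p′ k → p :* z :* (p′ :* k) := p :* p′ :* (k :* z)) refl p̂ U⁻¹ p̂⁻¹ (fromℕ U) ⟩
        p̂ * p̂⁻¹ * (fromℕ U * U⁻¹)  ≈⟨ *-cong p̂-inv (proj₂ U⁻¹-inverse) ⟩
        1# * 1#                     ≈⟨ *-identityˡ 1# ⟩
        1#                          ∎)

    -- The multiples of `p̂ / U` from 0 up to, but excluding, `p̂`. A sale at price 0 still earns
    -- the add-on revenue.
    corePrices : PriceSet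
    corePrices = record
      { size     = U
      ; nonEmpty = U-nonZero
      ; price    = λ i → fromℕ (toℕ i) * step
      ; nonNeg   = λ i → *-nonNeg (fromℕ-nonNeg (toℕ i)) (*-nonNeg 0≤p̂ 0≤U⁻¹)
      ; distinct = λ i j eq → toℕ-injective (fromℕ-injective
          (unit-cancelˡ (proj₂ step-unit) (trans (*-comm _ _) (trans eq (*-comm _ _)))))
      }

    corePrice≤p̂ : ∀ i → price corePrices i ≤ p̂
    corePrice≤p̂ i = begin
      fromℕ (toℕ i) * step  ≤⟨ *-monoʳ-≤ (*-nonNeg 0≤p̂ 0≤U⁻¹) (fromℕ-mono-≤ (ℕ.<⇒≤ (toℕ<n i))) ⟩
      fromℕ U * (p̂ * U⁻¹)   ≈⟨ solve 3 (λ k p z → k :* (p :* z) := p :* (k :* z)) refl (fromℕ U) p̂ U⁻¹ ⟩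
      p̂ * (fromℕ U * U⁻¹)   ≈⟨ *-congˡ (proj₂ U⁻¹-inverse) ⟩
      p̂ * 1#                ≈⟨ *-identityʳ p̂ ⟩
      p̂                     ∎

    singlePrice : ∀ p → 0# ≤ p → PriceSet
    singlePrice p 0≤p = record
      { size     = 1
      ; nonEmpty = _
      ; price    = λ _ → p
      ; nonNeg   = λ _ → 0≤p
      ; distinct = λ { zero zero _ → ≡.refl }
      }

    market : Market (suc N) (suc M)
    market = record
      { Ωc         = corePrices
      ; Ωs         = singlePrice p̂ 0≤p̂
      -- A discount price of 0 lies below `p̂`, so every policy meets the price constraint.
      ; Ωa         = singlePrice 0# ≤-refl
      ; spaceLimit = 0
      ; feasible   = zero , zero , 0<p̂
      }

    market-maxSize : Market.maxSize market ≡ U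
    market-maxSize = ≡.trans (ℕ.m≥n⇒m⊔n≡m (ℕ.≤-trans 0<U (ℕ.m≤m⊔n U 1))) (ℕ.m≥n⇒m⊔n≡m 0<U)
      where
      0<U : 0 ℕ.< U
      0<U = ℕ.>-nonZero⁻¹ U

    highestPrice : Market.IsHighestPrice market p̂
    highestPrice = (inj₂ zero , refl) , λ { (inj₁ i) → corePrice≤p̂ i ; (inj₂ _) → ≤-refl }

    policy : (Fin (suc N) → Fin U) → FeasiblePolicy market
    policy core = record
      { core     = core
      ; supp     = λ _ → zero
      ; discount = λ _ → zero
      ; selected = ⊥
      ; space    = ℕ.≤-reflexive (∣⊥∣≡0 (suc M))
      ; cheaper  = λ _ → 0<p̂
      }

    -- Revenue from the supportive products per core product sold.
    s : Carrier
    s = fromℕ (suc M) * p̂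

    p̂≤s : p̂ ≤ s
    p̂≤s = ≤-respˡ (*-identityˡ p̂) (*-monoʳ-≤ 0≤p̂ (1≤fromℕ-suc M))

    0≤s : 0# ≤ s
    0≤s = ≤-trans 0≤p̂ p̂≤s

    -- Expected revenue from one core sale, including what its buyer spends on add-ons.
    margin : Fin U → Carrier
    margin k = price corePrices k + s

    private
      s≤margin : ∀ k → s ≤ margin k
      s≤margin k = ≤-by-difference (nonNeg corePrices k) (+-comm s _)

      margin≤2s : ∀ k → margin k ≤ # 2 * s
      margin≤2s k = begin
        price corePrices k + s ≤⟨ +-monoˡ-≤ s (≤-trans (corePrice≤p̂ k) p̂≤s) ⟩
        s + s                  ≈⟨ solve 1 (λ s → s :+ s := con (+ 2) :* s) refl s ⟩
        # 2 * s                ∎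

      margin-inverse : ∀ k → ∃ λ z → margin k * z ≈ 1#
      margin-inverse k = inverse (margin k) λ margin≈0 →
        p̂≉0 (antisym (≤-respʳ margin≈0 (≤-trans p̂≤s (s≤margin k))) 0≤p̂)

      z : Fin U → Carrier
      z k = proj₁ (margin-inverse k)

      0≤z : ∀ k → 0# ≤ z k
      0≤z k = inverse-nonNeg (≤-trans 0≤s (s≤margin k)) (proj₂ (margin-inverse k))

    -- Makes all core prices equally profitable.
    baseline : Fin U → Carrier
    baseline k = # 2 * ¼ * (s * z k)

    baseline-margin : ∀ k → baseline k * margin k ≈ # 2 * ¼ * s
    baseline-margin k = begin-equality
      # 2 * ¼ * (s * z k) * margin k   ≈⟨ solve 4 (λ h s z m → h :* (s :* z) :* m := h :* s :* (m :* z))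
                                            refl (# 2 * ¼) s (z k) (margin k) ⟩
      # 2 * ¼ * s * (margin k * z k)   ≈⟨ *-congˡ (proj₂ (margin-inverse k)) ⟩
      # 2 * ¼ * s * 1#                 ≈⟨ *-identityʳ _ ⟩
      # 2 * ¼ * s                      ∎

    -- Core prices are at most `p̂`, hence at most `s`, so the margin is at most twice `s`. This
    -- keeps the chance of a sale away from zero.
    ¼≤baseline : ∀ k → ¼ ≤ baseline k
    ¼≤baseline k = begin
      ¼                      ≈⟨ *-identityʳ ¼ ⟨
      ¼ * 1#                 ≈⟨ *-congˡ (proj₂ (margin-inverse k)) ⟨
      ¼ * (margin k * z k)   ≤⟨ *-monoˡ-≤ 0≤¼ (*-monoʳ-≤ (0≤z k) (margin≤2s k)) ⟩
      ¼ * (# 2 * s * z k)    ≈⟨ solve 3 (λ q s z → q :* (con (+ 2) :* s :* z) := con (+ 2) :* q :* (s :* z))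
                                  refl ¼ s (z k) ⟩
      baseline k             ∎

    0≤baseline : ∀ k → 0# ≤ baseline k
    0≤baseline k = ≤-trans 0≤¼ (¼≤baseline k)

    -- The margin is at least `s`, so the baseline is at most one half and can be raised.
    baseline≤1-baseline : ∀ k → baseline k ≤ 1# - baseline k
    baseline≤1-baseline k = ≤-by-difference (x≤y⇒0≤y-x 2baseline≤1)
      (solve 1 (λ a → a :+ (con (+ 1) :- (a :+ a)) := con (+ 1) :- a) refl (baseline k))
      where
      2baseline≤1 : baseline k + baseline k ≤ 1#
      2baseline≤1 = begin
        baseline k + baseline k
          ≈⟨ solve 2 (λ q x → con (+ 2) :* q :* x :+ con (+ 2) :* q :* x := con (+ 4) :* q :* x) refl ¼ (s * z k) ⟩
        # 4 * ¼ * (s * z k)    ≈⟨ *-congʳ 4*¼ ⟩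
        1# * (s * z k)         ≈⟨ *-identityˡ _ ⟩
        s * z k                ≤⟨ *-monoʳ-≤ (0≤z k) (s≤margin k) ⟩
        margin k * z k         ≈⟨ proj₂ (margin-inverse k) ⟩
        1#                     ∎

    -- Regret over a horizon of `T` periods.

    module _ (T : ℕ) (U≤T : U ℕ.≤ T) where

      private
        t : Carrier
        t = fromℕ T

        T⁻¹-inverse : ∃ λ r → t * r ≈ 1#
        T⁻¹-inverse = inverse t (≥1⇒≉0 (≤-trans 1≤U (fromℕ-mono-≤ U≤T)))

        T⁻¹ : Carrier
        T⁻¹ = proj₁ T⁻¹-inverse

        0≤T⁻¹ : 0# ≤ T⁻¹
        0≤T⁻¹ = inverse-nonNeg (fromℕ-nonNeg T) (proj₂ T⁻¹-inverse)

      √UT : Carrier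
      √UT = √ fromℕ (U ℕ.* T)

      0≤√UT : 0# ≤ √UT
      0≤√UT = √-nonNeg (fromℕ-nonNeg (U ℕ.* T))

      √UT-square : √UT * √UT ≈ fromℕ U * t
      √UT-square = trans (√-square (fromℕ-nonNeg (U ℕ.* T))) (fromℕ-* U T)

      √UT≤T : √UT ≤ t
      √UT≤T = square-cancel-≤ 0≤√UT (fromℕ-nonNeg T)
        (≤-respˡ (sym √UT-square) (*-monoʳ-≤ (fromℕ-nonNeg T) (fromℕ-mono-≤ U≤T)))

      -- At this scale `ε² T = U / 16`, so the growth `9 ε² T` of the potential stays within the
      -- `3 U / 4` that `totalMisses-≥` tolerates. The bound `√UT ≤ t` keeps `ε` at most `¼`.
      ε : Carrier
      ε = ¼ * (√UT * T⁻¹)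

      0≤ε : 0# ≤ ε
      0≤ε = *-nonNeg 0≤¼ (*-nonNeg 0≤√UT 0≤T⁻¹)

      ε≤1 : ε ≤ 1#
      ε≤1 = begin
        ¼ * (√UT * T⁻¹)  ≤⟨ *-monoˡ-≤ 0≤¼ (*-monoʳ-≤ 0≤T⁻¹ √UT≤T) ⟩
        ¼ * (t * T⁻¹)    ≈⟨ *-congˡ (proj₂ T⁻¹-inverse) ⟩
        ¼ * 1#           ≈⟨ *-identityʳ ¼ ⟩
        ¼                ≤⟨ ¼≤1 ⟩
        1#               ∎

      ε*T : ε * t ≈ ¼ * √UT
      ε*T = begin-equality
        ¼ * (√UT * T⁻¹) * t    ≈⟨ solve 4 (λ q x r t → q :* (x :* r) :* t := q :* x :* (t :* r)) refl ¼ √UT T⁻¹ t ⟩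
        ¼ * √UT * (t * T⁻¹)    ≈⟨ *-congˡ (proj₂ T⁻¹-inverse) ⟩
        ¼ * √UT * 1#           ≈⟨ *-identityʳ _ ⟩
        ¼ * √UT                ∎

      ε²T : ε * ε * t ≈ ¼ * ¼ * fromℕ U
      ε²T = unit-cancelˡ (proj₂ T⁻¹-inverse) (begin-equality
        t * (ε * ε * t)            ≈⟨ solve 2 (λ t e → t :* (e :* e :* t) := e :* t :* (e :* t)) refl t ε ⟩
        ε * t * (ε * t)            ≈⟨ *-cong ε*T ε*T ⟩
        ¼ * √UT * (¼ * √UT)        ≈⟨ solve 2 (λ q x → q :* x :* (q :* x) := q :* q :* (x :* x)) refl ¼ √UT ⟩
        ¼ * ¼ * (√UT * √UT)        ≈⟨ *-congˡ √UT-square ⟩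
        ¼ * ¼ * (fromℕ U * t)      ≈⟨ solve 3 (λ q k t → q :* (k :* t) := t :* (q :* k)) refl (¼ * ¼) (fromℕ U) t ⟩
        t * (¼ * ¼ * fromℕ U)      ∎)

      36ε²T≤3U : # 36 * (ε * ε * t) ≤ # 3 * fromℕ U
      36ε²T≤3U = begin
        # 36 * (ε * ε * t)                       ≈⟨ *-congˡ ε²T ⟩
        # 36 * (¼ * ¼ * fromℕ U)                 ≤⟨ ≤-by-difference
          (*-nonNeg (#-nonNeg 12) (*-nonNeg (*-nonNeg 0≤¼ 0≤¼) (fromℕ-nonNeg U)))
          (solve 2 (λ q k → con (+ 36) :* (q :* q :* k) :+ con (+ 12) :* (q :* q :* k) :=
            con (+ 3) :* (con (+ 4) :* q :* (con (+ 4) :* q) :* k)) refl ¼ (fromℕ U)) ⟩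
        # 3 * (# 4 * ¼ * (# 4 * ¼) * fromℕ U)    ≈⟨ *-congˡ (*-congʳ (*-cong 4*¼ 4*¼)) ⟩
        # 3 * (1# * 1# * fromℕ U)                ≈⟨ *-congˡ (trans (*-congʳ (*-identityˡ 1#)) (*-identityˡ _)) ⟩
        # 3 * fromℕ U                            ∎

      open RaisedPrices market baseline 0≤baseline baseline≤1-baseline ε 0≤ε ε≤1 public

      -- What a core product gains per period at its hidden price: the fraction `ε` of the common
      -- baseline profit.
      gap : Carrier
      gap = # 2 * ¼ * s * ε

      module _ (v : Vec (Fin U) (suc N)) where
        open FeasiblePolicy
        open Demand (demand v)

        -- With space limit 0 every add-on is sold at `p̂` with probability 1, so each core sale
        -- brings `s` and the revenue splits over the core products.
        revenue-instance : ∀ Π → revenue market (demand v) Π ≈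
          fromℕ (suc N) * (# 2 * ¼ * s) + sum (λ n → gap * hit (lookup v n) (core Π n))
        revenue-instance Π = begin-equality
          coreRevenue + suppRevenue + sales * addOnRevenue
            ≈⟨ +-cong (trans (+-congˡ suppRevenue≈0) (+-identityʳ _)) (*-congˡ addOnRevenue≈s) ⟩
          coreRevenue + sales * s
            ≈⟨ +-congˡ (*-distribʳ-sum s sale) ⟩
          coreRevenue + sum (λ n → sale n * s)
            ≈⟨ ∑-distrib-+ (λ n → sale n * price corePrices (core Π n)) (λ n → sale n * s) ⟨
          sum (λ n → sale n * price corePrices (core Π n) + sale n * s)
            ≈⟨ sum-cong-≋ profit ⟩
          sum (λ n → # 2 * ¼ * s + gap * hit (lookup v n) (core Π n))
            ≈⟨ trans (∑-distrib-+ (λ _ → # 2 * ¼ * s) (λ n → gap * hit (lookup v n) (core Π n)))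
                     (+-congʳ (sum-const (suc N) _)) ⟩
          fromℕ (suc N) * (# 2 * ¼ * s) + sum (λ n → gap * hit (lookup v n) (core Π n)) ∎
          where
          I : Fin (suc M) → Carrier
          I m = if lookup (selected Π) m then 1# else 0#
          sale : Fin (suc N) → Carrier
          sale n = αc n (core Π n)
          coreRevenue suppRevenue sales addOnRevenue : Carrier
          coreRevenue = sum λ n → sale n * price corePrices (core Π n)
          suppRevenue = sum {suc M} λ m → 0# * p̂
          sales = sum sale
          addOnRevenue = sum λ m → I m * 0# * 0# + (1# - I m) * 1# * p̂
          suppRevenue≈0 : suppRevenue ≈ 0#
          suppRevenue≈0 = trans (sum-const (suc M) _)
            (solve 2 (λ m p → m :* (con (+ 0) :* p) := con (+ 0)) refl (fromℕ (suc M)) p̂)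
          addOnRevenue≈s : addOnRevenue ≈ s
          addOnRevenue≈s = trans
            (sum-cong-≋ λ m → trans
              (reflexive (≡.cong (λ b → let x = if b then 1# else 0# in x * 0# * 0# + (1# - x) * 1# * p̂)
                (unselected (selected Π) (space Π) m)))
              (solve 1 (λ p → con (+ 0) :* con (+ 0) :* con (+ 0) :+ (con (+ 1) :- con (+ 0)) :* con (+ 1) :* p := p)
                refl p̂))
            (sum-const (suc M) p̂)
          profit : ∀ n → sale n * price corePrices (core Π n) + sale n * s ≈
                         # 2 * ¼ * s + gap * hit (lookup v n) (core Π n)
          profit n = begin-equality
            sale n * price corePrices k + sale n * s
              ≈⟨ solve 5 (λ a e d p s →
                   a :* (con (+ 1) :+ e :* d) :* p :+ a :* (con (+ 1) :+ e :* d) :* s :=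
                   a :* (p :+ s) :+ a :* (p :+ s) :* e :* d)
                   refl (baseline k) ε (hit (lookup v n) k) (price corePrices k) s ⟩
            baseline k * margin k + baseline k * margin k * ε * hit (lookup v n) k
              ≈⟨ +-cong (baseline-margin k) (*-congʳ (*-congʳ (baseline-margin k))) ⟩
            # 2 * ¼ * s + gap * hit (lookup v n) k ∎
            where k = core Π n

        optimum : Carrier
        optimum = fromℕ (suc N) * (# 2 * ¼ * s) + fromℕ (suc N) * gap

        0≤gap : 0# ≤ gap
        0≤gap = *-nonNeg (*-nonNeg (*-nonNeg (#-nonNeg 2) 0≤¼) 0≤s) 0≤ε

        optimum-maximal : IsMaximum (revenue market (demand v)) optimum
        optimum-maximal =
          (policy (lookup v) , (begin-equality
            revenue market (demand v) (policy (lookup v))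
              ≈⟨ revenue-instance (policy (lookup v)) ⟩
            fromℕ (suc N) * (# 2 * ¼ * s) + sum (λ n → gap * hit (lookup v n) (lookup v n))
              ≈⟨ +-congˡ (sum-cong-≋ (λ n →
                   trans (*-congˡ (reflexive (hit-refl (lookup v n)))) (*-identityʳ gap))) ⟩
            fromℕ (suc N) * (# 2 * ¼ * s) + sum {suc N} (λ _ → gap)
              ≈⟨ +-congˡ (sum-const (suc N) gap) ⟩
            optimum ∎)) ,
          λ Π → begin
            revenue market (demand v) Π
              ≈⟨ revenue-instance Π ⟩
            fromℕ (suc N) * (# 2 * ¼ * s) + sum (λ n → gap * hit (lookup v n) (core Π n))
              ≤⟨ +-monoʳ-≤ _ (sum-mono-≤ (λ n →
                   ≤-respʳ (*-identityʳ gap) (*-monoˡ-≤ 0≤gap (hit-≤1 (lookup v n) (core Π n))))) ⟩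
            fromℕ (suc N) * (# 2 * ¼ * s) + sum {suc N} (λ _ → gap)
              ≈⟨ +-congˡ (sum-const (suc N) gap) ⟩
            optimum ∎

        leastSale : ∀ n → ∃[ k ] ∀ j → αc n k ≤ αc n j
        leastSale n = argmin (αc n)

        -- Even at its least-selling price the first core product sells with probability at least
        -- `¼`. Thus the factor 1/λ of the upper bound stays bounded on these instances.
        ℙ-nonzeroPrimary-minimum :
          ∃[ lam ] IsMinimum (ℙ-nonzeroPrimary market (demand v)) lam × κ ≤ lam
        ℙ-nonzeroPrimary-minimum =
          ℙ-nonzeroPrimary market (demand v) Π₀ ,
          ((Π₀ , refl) , λ Π → ℙ-any-mono r-prob
            (λ n → αc-prob n (core Π₀ n)) (λ n → αc-prob n (core Π n))
            (λ n → proj₂ (leastSale n) (core Π n))) ,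
          (begin
            κ                      ≤⟨ κ≤¼ ⟩
            ¼                      ≤⟨ ¼≤baseline k₀ ⟩
            baseline k₀            ≤⟨ ≤-by-difference
              (*-nonNeg (0≤baseline k₀) (*-nonNeg 0≤ε (hit-nonNeg (lookup v zero) k₀)))
              (solve 2 (λ a e → a :+ a :* e := a :* (con (+ 1) :+ e)) refl (baseline k₀) _) ⟩
            αc zero k₀             ≤⟨ head≤ℙ-any r-prob (λ n → αc-prob n (core Π₀ n)) ⟩
            ℙ-nonzeroPrimary market (demand v) Π₀ ∎)
          where
          Π₀ = policy (proj₁ ∘ leastSale)
          k₀ = proj₁ (leastSale zero)
          r-prob : (m : Fin (suc M)) → Probability 0#
          r-prob _ = ≤-refl , 0≤1

      module _ (𝓐 : Algorithm market) where
        open FeasiblePolicy using (core)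

        expectedHits : Fin (suc N) → Vec (Fin U) (suc N) → Carrier
        expectedHits n v = hits 𝓐 n v [] T

        -- The loss of a policy is affine in the indicators that its core prices are the hidden
        -- ones, so `cumulative-affine` reduces the regret to expected hits.
        regret-instance : ∀ v → regret market (demand v) (optimum v) 𝓐 T ≈
          gap * sum (λ n → t - expectedHits n v)
        regret-instance v = begin-equality
          regret market (demand v) (optimum v) 𝓐 T
            ≈⟨ regretFrom-cumulative market (demand v) 𝓐 loss [] T ⟩
          cumulative market (demand v) 𝓐 (λ Π → fromℕ (suc N) * gap +
            sum (λ n → - gap * hit (lookup v n) (core Π n))) [] T
            ≈⟨ cumulative-affine market (demand v) 𝓐 (fromℕ (suc N) * gap) (λ _ → - gap)
                 (λ n Π → hit (lookup v n) (core Π n)) [] T ⟩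
          t * (fromℕ (suc N) * gap) + sum (λ n → - gap * expectedHits n v)
            ≈⟨ +-congʳ (trans (solve 3 (λ t n g → t :* (n :* g) := n :* (g :* t)) refl t (fromℕ (suc N)) gap)
                 (sym (sum-const (suc N) (gap * t)))) ⟩
          sum {suc N} (λ _ → gap * t) + sum (λ n → - gap * expectedHits n v)
            ≈⟨ ∑-distrib-+ {suc N} (λ _ → gap * t) (λ n → - gap * expectedHits n v) ⟨
          sum (λ n → gap * t + - gap * expectedHits n v)
            ≈⟨ sum-cong-≋ (λ n → solve 3 (λ g t x → g :* t :+ :- g :* x := g :* (t :- x)) refl gap t (expectedHits n v)) ⟩
          sum (λ n → gap * (t - expectedHits n v))
            ≈⟨ *-distribˡ-sum gap (λ n → t - expectedHits n v) ⟨
          gap * sum (λ n → t - expectedHits n v) ∎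
          where
          loss : ∀ Π → optimum v - revenue market (demand v) Π ≈
                 fromℕ (suc N) * gap + sum (λ n → - gap * hit (lookup v n) (core Π n))
          loss Π = begin-equality
            optimum v - revenue market (demand v) Π
              ≈⟨ +-congˡ (-‿cong (trans (revenue-instance v Π)
                   (+-congˡ (sym (*-distribˡ-sum gap (λ n → hit (lookup v n) (core Π n))))))) ⟩
            fromℕ (suc N) * (# 2 * ¼ * s) + fromℕ (suc N) * gap -
              (fromℕ (suc N) * (# 2 * ¼ * s) + gap * H)
              ≈⟨ solve 4 (λ x y g h → x :+ y :- (x :+ g :* h) := y :+ :- g :* h) refl
                   (fromℕ (suc N) * (# 2 * ¼ * s)) (fromℕ (suc N) * gap) gap H ⟩
            fromℕ (suc N) * gap + - gap * H
              ≈⟨ +-congˡ (*-distribˡ-sum (- gap) (λ n → hit (lookup v n) (core Π n))) ⟩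
            fromℕ (suc N) * gap + sum (λ n → - gap * hit (lookup v n) (core Π n)) ∎
            where H = sum λ n → hit (lookup v n) (core Π n)

        misses-average : ∀ n v → fromℕ U * t ≤ sum (λ i → # 32 * (t - expectedHits n (v [ n ]≔ i)))
        misses-average n v = totalMisses-≥ 𝓐 n v T [] 36ε²T≤3U 2≤U

        hardVector : ∃[ v ] fromℕ (suc N) * t ≤ sum (λ n → # 32 * (t - expectedHits n v))
        hardVector = coordinatewise-average (suc N) (λ n v → # 32 * (t - expectedHits n v)) t misses-average

        regret-lowerBound : ∃[ v ] κ * (fromℕ (suc N) * fromℕ (suc M) * p̂ * √UT) ≤
                                   regret market (demand v) (optimum v) 𝓐 T
        regret-lowerBound = let v , misses-≥ = hardVector in v , unit-cancelˡ-≤ (#-nonNeg 32) 32-unit (begin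
          # 32 * (κ * (fromℕ (suc N) * fromℕ (suc M) * p̂ * √UT))
            ≈⟨ solve 5 (λ q n m p x →
                 con (+ 32) :* (q :* q :* (q :* q) :* (n :* m :* p :* x)) :=
                 con (+ 4) :* q :* (con (+ 4) :* q) :* (con (+ 2) :* q :* (m :* p) :* (q :* x) :* n))
                 refl ¼ (fromℕ (suc N)) (fromℕ (suc M)) p̂ √UT ⟩
          # 4 * ¼ * (# 4 * ¼) * (# 2 * ¼ * s * (¼ * √UT) * fromℕ (suc N))
            -- `32 κ` is one half times one quarter, and the quarter turns `√UT` into `ε * t`.
            ≈⟨ *-cong (*-cong 4*¼ 4*¼) (*-congʳ (*-congˡ (sym ε*T))) ⟩
          1# * 1# * (# 2 * ¼ * s * (ε * t) * fromℕ (suc N))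
            ≈⟨ solve 4 (λ x e t n → con (+ 1) :* con (+ 1) :* (x :* (e :* t) :* n) := x :* e :* (n :* t))
                 refl (# 2 * ¼ * s) ε t (fromℕ (suc N)) ⟩
          gap * (fromℕ (suc N) * t)
            ≤⟨ *-monoˡ-≤ (0≤gap v) misses-≥ ⟩
          gap * sum (λ n → # 32 * (t - expectedHits n v))
            ≈⟨ *-congˡ (*-distribˡ-sum (# 32) (λ n → t - expectedHits n v)) ⟨
          gap * (# 32 * sum (λ n → t - expectedHits n v))
            ≈⟨ solve 2 (λ g x → g :* (con (+ 32) :* x) := con (+ 32) :* (g :* x))
                 refl gap (sum (λ n → t - expectedHits n v)) ⟩
          # 32 * (gap * sum (λ n → t - expectedHits n v))
            ≈⟨ *-congˡ (regret-instance v) ⟨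
          # 32 * regret market (demand v) (optimum v) 𝓐 T ∎)
          where
          32-unit : # 32 * (# 2 * ¼ * ¼ * ¼) ≈ 1#
          32-unit = begin-equality
            # 32 * (# 2 * ¼ * ¼ * ¼)
              ≈⟨ solve 1 (λ q → con (+ 32) :* (con (+ 2) :* q :* q :* q) :=
                   con (+ 4) :* q :* (con (+ 4) :* q) :* (con (+ 4) :* q)) refl ¼ ⟩
            # 4 * ¼ * (# 4 * ¼) * (# 4 * ¼) ≈⟨ *-cong (*-cong 4*¼ 4*¼) 4*¼ ⟩
            1# * 1# * 1#                    ≈⟨ trans (*-identityʳ _) (*-identityʳ _) ⟩
            1#                              ∎

mainTheorem3 : ∀ {c ℓ₁ ℓ₂} (F : EuclideanField c ℓ₁ ℓ₂) →
    let open EuclideanField F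
        open AddOnDiscount F
        open Market
        open Demand
    in
    ∃[ κ ] 0# < κ ×
    (∀ (N M U T : ℕ) (p̂ : Carrier) →
      1 ℕ.≤ N → 1 ℕ.≤ M → 2 ℕ.≤ U → U ℕ.≤ T → 0# < p̂ →
      Σ[ 𝓜 ∈ Market N M ]
        spaceLimit 𝓜 ≡ 0 ×
        maxSize 𝓜 ≡ U ×
        IsHighestPrice 𝓜 p̂ ×
        (∀ j → price (Ωs 𝓜) j ≈ p̂) ×
        (∀ (𝓐 : Algorithm 𝓜) →
          Σ[ D ∈ Demand 𝓜 ]
            (∀ m j → αs D m j ≈ 0#) ×
            (∀ m j → β D m j ≈ 1#) ×
            (∃[ lam ] IsMinimum (ℙ-nonzeroPrimary 𝓜 D) lam × κ ≤ lam) ×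
            (∃[ R* ] IsMaximum (revenue 𝓜 D) R* ×
              (κ * (fromℕ N * fromℕ M * p̂ * (√ fromℕ (U ℕ.* T)))) ≤ regret 𝓜 D R* 𝓐 T)))
mainTheorem3 F = κ , 0<κ , λ
  { (suc N) (suc M) U T p̂ _ _ 2≤U U≤T 0<p̂ →
    let open Construction N M U 2≤U p̂ 0<p̂ in
    -- The market depends on neither `T` nor `𝓐`. Only the demand is fitted to them.
    market , ≡.refl , market-maxSize , highestPrice , (λ _ → refl) , λ 𝓐 →
    let v , regret-≥ = regret-lowerBound T U≤T 𝓐 in
    demand T U≤T v , (λ _ _ → refl) , (λ _ _ → refl) ,
    ℙ-nonzeroPrimary-minimum T U≤T v ,
    optimum T U≤T v , optimum-maximal T U≤T v , regret-≥ }
  where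
  open EuclideanField F using (refl)
  open HardInstance F
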